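{- Let $\Sigma,\Delta,\Gamma\in\mathcal{G}_n$ be pairwise generalized cospectral. Suppose there exist $Q,Q_1\in\mathcal{Q}(\Sigma)$ with the same level $\ell$ such that $Q^{\rm T}S(\Sigma)Q=S(\Delta)$ and $Q_1^{\rm T}S(\Sigma)Q_1=S(\Gamma)$. Then $\Delta$ is isomorphic to $\Gamma$.
   Context: An oriented graph $\Sigma$ on vertices $v_1,\dots,v_n$ is a simple graph with each edge given a direction. Its skew-adjacency matrix $S(\Sigma)=(s_{ij})$ has $s_{ij}=1$ if $(v_i,v_j)$ is an arc, $s_{ij}=-1$ if $(v_j,v_i)$ is an arc, and $0$ otherwise. Two oriented graphs $\Sigma,\Delta$ are isomorphic if $P^{\rm T}S(\Sigma)P=S(\Delta)$ for some permutation matrix $P$; they are generalized cospectral if $S(\Sigma)$ and $S(\Delta)$ have the same spectrum and $J-I-S(\Sigma)$ and $J-I-S(\Delta)$ have the same spectrum ($J$ the all-one matrix). The skew-walk matrix is $W(\Sigma)=[e,Se,\dots,S^{n-1}e]$ with $S=S(\Sigma)$, $e$ the all-one vector. $\mathcal{G}_n$ is the set of $n$-vertex oriented graphs $\Sigma$ such that $2^{ -\lfloor n/2\rfloor}\det W(\Sigma)$ is an odd square-free integer. A rational orthogonal matrix $Q$ is regular if $Qe=e$; its level is the smallest positive integer $k$ with $kQ$ integral. $\mathcal{Q}(\Sigma)$ is the set of regular rational orthogonal matrices $Q$ such that $Q^{\rm T}S(\Sigma)Q=S(\Delta')$ for some oriented graph $\Delta'$ generalized cospectral with $\Sigma$.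 -}

module Defs where

open import Data.Nat as ℕ using (ℕ; zero; suc; ⌊_/2⌋; _≤_; _<_)
open import Data.Nat.Primality using (Prime)
open import Data.Fin using (Fin; zero; suc; toℕ; punchIn)
open import Data.Fin.Permutation using (Permutation′; _⟨$⟩ʳ_)
open import Data.Integer as ℤ using (ℤ; +_; -[1+_])
open import Data.Integer.Divisibility as ℤD using ()
open import Data.Rational as ℚ using (ℚ)
open import Data.Product using (Σ; ∃; _×_; _,_)
open import Data.Sum using (_⊎_)
open import Relation.Binary.PropositionalEquality using (_≡_)
open import Relation.Nullary using (¬_)

Mat : Set → ℕ → Set
Mat A n = Fin n → Fin n → A

sumℤ : ∀ {n} → (Fin n → ℤ) → ℤ
sumℤ {zero}  f = + 0
sumℤ {suc n} f = f zero ℤ.+ sumℤ (λ i → f (suc i))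

sumℚ : ∀ {n} → (Fin n → ℚ) → ℚ
sumℚ {zero}  f = ℚ.0ℚ
sumℚ {suc n} f = f zero ℚ.+ sumℚ (λ i → f (suc i))

sign : ℕ → ℤ
sign zero          = + 1
sign (suc zero)    = ℤ.- (+ 1)
sign (suc (suc k)) = sign k

det : ∀ {n} → Mat ℤ n → ℤ
det {zero}  A = + 1
det {suc n} A =
  sumℤ (λ j → sign (toℕ j) ℤ.* (A zero j ℤ.* det (λ i k → A (suc i) (punchIn j k))))

idℤ : ∀ {n} → Mat ℤ n
idℤ i j with i Data.Fin.≟ j
... | Relation.Nullary.yes _ = + 1
... | Relation.Nullary.no  _ = + 0

Jℤ : ∀ {n} → Mat ℤ n
Jℤ i j = + 1

charPolyAt : ∀ {n} → Mat ℤ n → ℤ → ℤ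
charPolyAt A x = det (λ i j → (x ℤ.* idℤ i j) ℤ.- A i j)

-- same spectrum = same characteristic polynomial; two monic integer
-- polynomials coincide iff they agree at every integer
SameSpectrum : ∀ {n} → Mat ℤ n → Mat ℤ n → Set
SameSpectrum A B = ∀ (x : ℤ) → charPolyAt A x ≡ charPolyAt B x

-- Oriented graphs, given by their skew-adjacency matrices

IsSkewEntry : ℤ → Set
IsSkewEntry z = (z ≡ + 0) ⊎ ((z ≡ + 1) ⊎ (z ≡ -[1+ 0 ]))

record OrientedGraph (n : ℕ) : Set where
  field
    S       : Mat ℤ n
    entries : ∀ i j → IsSkewEntry (S i j)
    diag    : ∀ i → S i i ≡ + 0
    skew    : ∀ i j → S j i ≡ ℤ.- (S i j)
open OrientedGraph public

-- isomorphism: P^T S(Σ) P = S(Δ) for a permutation matrix P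
-- (entrywise: S(Δ)_{ij} = S(Σ)_{σ(i) σ(j)})
Isomorphic : ∀ {n} → OrientedGraph n → OrientedGraph n → Set
Isomorphic {n} Σ' Δ =
  ∃ λ (σ : Permutation′ n) → ∀ i j → S Δ i j ≡ S Σ' (σ ⟨$⟩ʳ i) (σ ⟨$⟩ʳ j)

GenCospectral : ∀ {n} → OrientedGraph n → OrientedGraph n → Set
GenCospectral Σ' Δ =
  SameSpectrum (S Σ') (S Δ) ×
  SameSpectrum (λ i j → (Jℤ i j ℤ.- idℤ i j) ℤ.- S Σ' i j)
               (λ i j → (Jℤ i j ℤ.- idℤ i j) ℤ.- S Δ i j)

matVec : ∀ {n} → Mat ℤ n → (Fin n → ℤ) → (Fin n → ℤ)
matVec A v i = sumℤ (λ k → A i k ℤ.* v k)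

walkVec : ∀ {n} → Mat ℤ n → ℕ → (Fin n → ℤ)
walkVec A zero    = λ _ → + 1
walkVec A (suc k) = matVec A (walkVec A k)

walkMatrix : ∀ {n} → OrientedGraph n → Mat ℤ n
walkMatrix Σ' i j = walkVec (S Σ') (toℕ j) i

Odd : ℤ → Set
Odd m = ¬ (+ 2 ℤD.∣ m)

SquareFree : ℤ → Set
SquareFree m = ∀ (p : ℕ) → Prime p → ¬ ((+ p) ℤ.* (+ p) ℤD.∣ m)

InG : ∀ {n} → OrientedGraph n → Set
InG {n} Σ' =
  ∃ λ (m : ℤ) → (det (walkMatrix Σ') ≡ (+ (2 ℕ.^ ⌊ n /2⌋)) ℤ.* m) × Odd m × SquareFree m

toℚ : ℤ → ℚ
toℚ z = z ℚ./ 1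

idℚ : ∀ {n} → Mat ℚ n
idℚ i j = toℚ (idℤ i j)

_·_ : ∀ {n} → Mat ℚ n → Mat ℚ n → Mat ℚ n
(A · B) i j = sumℚ (λ k → A i k ℚ.* B k j)

transpose : ∀ {n} → Mat ℚ n → Mat ℚ n
transpose A i j = A j i

toℚMat : ∀ {n} → Mat ℤ n → Mat ℚ n
toℚMat A i j = toℚ (A i j)

conj : ∀ {n} → Mat ℚ n → Mat ℤ n → Mat ℚ n
conj Q A = (transpose Q · toℚMat A) · Q

Orthogonal : ∀ {n} → Mat ℚ n → Set
Orthogonal Q = ∀ i j → (transpose Q · Q) i j ≡ idℚ i j

Regular : ∀ {n} → Mat ℚ n → Set
Regular Q = ∀ i → sumℚ (λ k → Q i k) ≡ ℚ.1ℚ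

IntegralMat : ∀ {n} → Mat ℚ n → Set
IntegralMat A = ∀ i j → ∃ λ (z : ℤ) → A i j ≡ toℚ z

scale : ∀ {n} → ℕ → Mat ℚ n → Mat ℚ n
scale k A i j = toℚ (+ k) ℚ.* A i j

HasLevel : ∀ {n} → Mat ℚ n → ℕ → Set
HasLevel Q ℓ =
  (0 < ℓ) × IntegralMat (scale ℓ Q) ×
  (∀ (k : ℕ) → 0 < k → IntegralMat (scale k Q) → ℓ ≤ k)

InQ : ∀ {n} → OrientedGraph n → Mat ℚ n → Set
InQ {n} Σ' Q =
  Orthogonal Q × Regular Q ×
  (∃ λ (Δ' : OrientedGraph n) →
     GenCospectral Σ' Δ' × (∀ i j → conj Q (S Σ') i j ≡ toℚ (S Δ' i j)))

-- With N = ℓQ and N₁ = ℓQ₁ integral, the orthogonal matrix QᵀQ₁ conjugates S(Δ) to S(Γ), so it suffices to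
-- show that it is integral: an integral orthogonal matrix whose rows and columns sum to 1 is a permutation
-- matrix.  That is, ℓ² must divide every x·y with x a column of N and y a column of N₁.
--
-- All these columns lie in the kernel of Wᵀ modulo ℓ, where W = W(Σ), and k vectors of the kernel of Wᵀ modulo p
-- that are independent modulo p force pᵏ ∣ det W.
-- For p odd, p² does not divide det W, so any two columns x, y are dependent modulo p; as x·x ≡ y·y ≡ 0 (mod p²),
-- squaring the dependency gives x·y ≡ 0 (mod p²).  Moreover p² does not divide ℓ.
-- For p = 2, let n = 2r + s with s ≤ 1.  If ℓ were even, a column y of N that is nonzero modulo 2 would be
-- independent of the r vectors Sˢe, …, Sˢ⁺ʳ⁻¹e, which also lie in the kernel modulo 2, and 2ʳ⁺¹ would divide det W.
-- Indeed, if a combination v = Σ cₐSˢ⁺ᵃe is congruent to a multiple of y modulo 2, then |Sᵇv|² ≡ 0 (mod 4) for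
-- all b.  Up to signs and modulo 4 this says that the vector with entry cₐ at index s + 2a is killed by WᵀW, but
-- WᵀW with its last 2r columns halved is an integral matrix, of odd determinant because det W has 2-adic
-- valuation r; so all cₐ are even.
module Submission where

open import Defs
open import Algebra.Bundles using (CommutativeMonoid)
import Algebra.Properties.CommutativeSemigroup as CommutativeSemigroupProperties
open import Data.Fin as Fin using (Fin; zero; suc; toℕ; punchIn; punchOut)
open import Data.Fin.Permutation using (Permutation′; permutation; _⟨$⟩ʳ_)
open import Data.Fin.Properties using
  (all?; punchInᵢ≢i; punchIn-injective; punchIn-punchOut; suc-injective; ¬∀⟶∃¬)
open import Data.Integer as ℤ using (ℤ; -[1+_]; 0ℤ; 1ℤ; -1ℤ; _+_; _*_; -_; _-_; _^_) renaming (+_ to pos)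
open import Data.Integer.Divisibility.Signed
open import Data.Integer.Properties as ℤₚ using
  (+-identityˡ; +-identityʳ; *-identityˡ; *-identityʳ; *-zeroˡ; *-zeroʳ; *-comm; *-assoc; *-distribˡ-+; +-inverseʳ)
open import Data.Integer.Tactic.RingSolver using (solve-∀)
import Data.List.Base as List
import Data.List.Relation.Unary.All as All
open import Data.Nat as ℕ using (ℕ; zero; suc; ⌊_/2⌋)
import Data.Nat.Divisibility as ℕDiv
open import Data.Nat.Induction using (<-rec)
open import Data.Nat.ListAction using (product)
open import Data.Nat.Primality using
  (Prime; euclidsLemma; prime⇒irreducible; prime⇒nonTrivial; prime⇒nonZero; prime[2]; ¬prime[1])
open import Data.Nat.Primality.Factorisation using (factorise)
import Data.Nat.Properties as ℕₚ
open import Data.Nat.Tactic.RingSolver using () renaming (solve-∀ to solveℕ-∀)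
open import Data.Product using (∃; ∃₂; _×_; _,_; proj₁; proj₂)
open import Data.Rational as ℚ using (ℚ; 0ℚ; 1ℚ)
open import Data.Rational.Properties as ℚₚ using
  (fromℚᵘ-injective; toℚᵘ-fromℚᵘ; toℚᵘ-homo-+; toℚᵘ-homo-*; toℚᵘ-injective)
open import Data.Rational.Unnormalised using (mkℚᵘ; *≡*)
import Data.Rational.Unnormalised.Properties as ℚᵘₚ
open import Data.Sum as Sum using (_⊎_; inj₁; inj₂; [_,_]′)
open import Data.Vec.Functional using (_∷_; updateAt)
open import Data.Vec.Functional.Properties using (updateAt-updates; updateAt-minimal)
open import Function using (_∘_; const)
open import Relation.Binary.PropositionalEquality
open import Relation.Nullary using (¬_; yes; no; contradiction)

open ≡-Reasoning

-- Finite sums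

sum-cong : ∀ {n} {f g : Fin n → ℤ} → (∀ i → f i ≡ g i) → sumℤ f ≡ sumℤ g
sum-cong {zero}  f≗g = refl
sum-cong {suc n} f≗g = cong₂ _+_ (f≗g zero) (sum-cong (f≗g ∘ suc))

sum-zero : ∀ {n} {f : Fin n → ℤ} → (∀ i → f i ≡ 0ℤ) → sumℤ f ≡ 0ℤ
sum-zero {zero}  f≗0 = refl
sum-zero {suc n} f≗0 = cong₂ _+_ (f≗0 zero) (sum-zero (f≗0 ∘ suc))

sum-linear : ∀ {n} α β (f g : Fin n → ℤ) →
  sumℤ (λ i → α * f i + β * g i) ≡ α * sumℤ f + β * sumℤ g
sum-linear {zero}  α β f g = sym (cong₂ _+_ (*-zeroʳ α) (*-zeroʳ β))
sum-linear {suc n} α β f g =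
  trans (cong (α * f zero + β * g zero +_) (sum-linear α β (f ∘ suc) (g ∘ suc)))
        (rearrange α β (f zero) (g zero) (sumℤ (f ∘ suc)) (sumℤ (g ∘ suc)))
  where
  rearrange : ∀ α β a b c d → (α * a + β * b) + (α * c + β * d) ≡ α * (a + c) + β * (b + d)
  rearrange = solve-∀

sum-+ : ∀ {n} (f g : Fin n → ℤ) → sumℤ (λ i → f i + g i) ≡ sumℤ f + sumℤ g
sum-+ {zero}  f g = refl
sum-+ {suc n} f g =
  trans (cong (f zero + g zero +_) (sum-+ (f ∘ suc) (g ∘ suc)))
        (rearrange (f zero) (g zero) (sumℤ (f ∘ suc)) (sumℤ (g ∘ suc)))
  where
  rearrange : ∀ a b c d → (a + b) + (c + d) ≡ (a + c) + (b + d)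
  rearrange = solve-∀

*-sum : ∀ {n} α (f : Fin n → ℤ) → α * sumℤ f ≡ sumℤ (λ i → α * f i)
*-sum {zero}  α f = *-zeroʳ α
*-sum {suc n} α f =
  trans (*-distribˡ-+ α (f zero) (sumℤ (f ∘ suc))) (cong (α * f zero +_) (*-sum α (f ∘ suc)))

sum-* : ∀ {n} α (f : Fin n → ℤ) → sumℤ f * α ≡ sumℤ (λ i → f i * α)
sum-* α f = trans (*-comm (sumℤ f) α) (trans (*-sum α f) (sum-cong (λ i → *-comm α (f i))))

sum-swap : ∀ {m n} (f : Fin m → Fin n → ℤ) →
  sumℤ (λ i → sumℤ (f i)) ≡ sumℤ (λ j → sumℤ (λ i → f i j))
sum-swap {zero} {n} f = sym (sum-zero {n} (λ _ → refl))
sum-swap {suc m} f =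
  trans (cong (sumℤ (f zero) +_) (sum-swap (f ∘ suc))) (sym (sum-+ (f zero) (λ j → sumℤ (λ i → f (suc i) j))))

sum-punchIn : ∀ {n} (k : Fin (suc n)) (f : Fin (suc n) → ℤ) →
  sumℤ f ≡ sumℤ (f ∘ punchIn k) + f k
sum-punchIn zero f = ℤₚ.+-comm (f zero) (sumℤ (f ∘ suc))
sum-punchIn {suc n} (suc k) f =
  trans (cong (f zero +_) (sum-punchIn k (f ∘ suc)))
        (sym (ℤₚ.+-assoc (f zero) (sumℤ (f ∘ suc ∘ punchIn k)) (f (suc k))))

sum-single : ∀ {n} (k : Fin n) (f : Fin n → ℤ) → (∀ i → i ≢ k → f i ≡ 0ℤ) → sumℤ f ≡ f k
sum-single {suc n} k f f≗0 =
  trans (sum-punchIn k f)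
        (trans (cong (_+ f k) (sum-zero (λ i → f≗0 (punchIn k i) (punchInᵢ≢i k i)))) (+-identityˡ _))

-- Determinants as alternating forms

-- Alternation is demanded only for neighbours, which the expansion along row zero gives directly;
-- `repeated` recovers arbitrary positions. The inductive form lets `there` pass a fixed first
-- member.
data Adjacent : ∀ {m} → Fin m → Fin m → Set where
  here  : ∀ {m} → Adjacent {suc (suc m)} zero (suc zero)
  there : ∀ {m} {i j : Fin m} → Adjacent i j → Adjacent (suc i) (suc j)

sum-adjacent : ∀ {m} {i j : Fin m} → Adjacent i j → (f : Fin m → ℤ) →
  f i + f j ≡ 0ℤ → (∀ k → k ≢ i → k ≢ j → f k ≡ 0ℤ) → sumℤ f ≡ 0ℤ
sum-adjacent here f f≡0 f≗0 = begin
  f zero + (f (suc zero) + sumℤ (λ k → f (suc (suc k))))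
    ≡⟨ cong (λ s → f zero + (f (suc zero) + s)) (sum-zero (λ k → f≗0 (suc (suc k)) (λ ()) (λ ()))) ⟩
  f zero + (f (suc zero) + 0ℤ) ≡⟨ cong (f zero +_) (+-identityʳ _) ⟩
  f zero + f (suc zero)        ≡⟨ f≡0 ⟩
  0ℤ ∎
sum-adjacent (there a) f f≡0 f≗0 =
  cong₂ _+_ (f≗0 zero (λ ()) (λ ()))
    (sum-adjacent a (f ∘ suc) f≡0 (λ k k≢i k≢j → f≗0 (suc k) (k≢i ∘ suc-injective) (k≢j ∘ suc-injective)))

punchIn-adjacent : ∀ {m} {i j : Fin (suc m)} → Adjacent i j → (k : Fin (suc m)) → k ≢ i → k ≢ j →
  ∃₂ λ i′ j′ → Adjacent i′ j′ × punchIn k i′ ≡ i × punchIn k j′ ≡ j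
punchIn-adjacent here zero k≢i k≢j = contradiction refl k≢i
punchIn-adjacent here (suc zero) k≢i k≢j = contradiction refl k≢j
punchIn-adjacent {suc (suc m)} here (suc (suc k)) k≢i k≢j = zero , suc zero , here , refl , refl
punchIn-adjacent (there {i = i} {j} a) zero k≢i k≢j = i , j , a , refl , refl
punchIn-adjacent {suc m} (there a) (suc k) k≢i k≢j
  with punchIn-adjacent a k (k≢i ∘ cong suc) (k≢j ∘ cong suc)
... | i′ , j′ , a′ , i≡ , j≡ = suc i′ , suc j′ , there a′ , cong suc i≡ , cong suc j≡

-- Compares the two minors that have to cancel in `detCols-alternating`: the lists without `i` and
-- without `j` differ only at the place where the other neighbour survives.
punchIn-swap : ∀ {m} {i j : Fin (suc m)} → Adjacent i j → (t : Fin m) →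
  punchIn i t ≡ punchIn j t ⊎ (punchIn i t ≡ j × punchIn j t ≡ i)
punchIn-swap here zero = inj₂ (refl , refl)
punchIn-swap here (suc t) = inj₁ refl
punchIn-swap (there a) zero = inj₁ refl
punchIn-swap (there a) (suc t) with punchIn-swap a t
... | inj₁ eq = inj₁ (cong suc eq)
... | inj₂ (eq , eq′) = inj₂ (cong suc eq , cong suc eq′)

sign-suc : ∀ k → sign (suc k) ≡ - sign k
sign-suc zero = refl
sign-suc (suc zero) = refl
sign-suc (suc (suc k)) = sign-suc k

sign-square : ∀ k → sign k * sign k ≡ 1ℤ
sign-square zero = refl
sign-square (suc zero) = refl
sign-square (suc (suc k)) = sign-square k

sign-adjacent : ∀ {m} {i j : Fin m} → Adjacent i j → sign (toℕ j) ≡ - sign (toℕ i)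
sign-adjacent here = refl
sign-adjacent (there {i = i} {j} a) = begin
  sign (suc (toℕ j)) ≡⟨ sign-suc (toℕ j) ⟩
  - sign (toℕ j)     ≡⟨ cong -_ (sign-adjacent a) ⟩
  - - sign (toℕ i)   ≡⟨ cong -_ (sign-suc (toℕ i)) ⟨
  - sign (suc (toℕ i)) ∎

-- `m` vectors of length `n`. The two numbers are kept apart because fixing the leading members of a
-- determinant leaves a form in fewer vectors of the same length.
Family : ℕ → ℕ → Set
Family m n = Fin m → Fin n → ℤ

_≋_ : ∀ {m n} → Family m n → Family m n → Set
X ≋ Y = ∀ i t → X i t ≡ Y i t

comb : ∀ {m n} → (Fin m → ℤ) → Family m n → Fin n → ℤ
comb c X t = sumℤ (λ k → c k * X k t)

AgreeOff : ∀ {m n} → Fin m → Family m n → Family m n → Set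
AgreeOff i X Y = ∀ j → j ≢ i → ∀ t → X j t ≡ Y j t

-- Linearity is stated relationally, so that it applies to families that are not literally updates.
record AltForm {m n} (F : Family m n → ℤ) : Set where
  field
    congruent   : ∀ {X Y} → X ≋ Y → F X ≡ F Y
    linear      : ∀ i α β {X Y Z} → AgreeOff i X Y → AgreeOff i X Z →
                  (∀ t → X i t ≡ α * Y i t + β * Z i t) → F X ≡ α * F Y + β * F Z
    alternating : ∀ {i j} → Adjacent i j → ∀ {X} → (∀ t → X i t ≡ X j t) → F X ≡ 0ℤ

cons-≋ : ∀ {m n} {x y : Fin n → ℤ} {X Y : Family m n} →
  (∀ t → x t ≡ y t) → X ≋ Y → (x ∷ X) ≋ (y ∷ Y)
cons-≋ x≗y X≋Y zero = x≗y
cons-≋ x≗y X≋Y (suc i) = X≋Y i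

cons-η : ∀ {m n} (X : Family (suc m) n) → X ≋ (X zero ∷ X ∘ suc)
cons-η X = λ { zero t → refl ; (suc i) t → refl }

cons-form : ∀ {m n} {F : Family (suc m) n → ℤ} → AltForm F → ∀ x → AltForm (F ∘ (x ∷_))
cons-form {m} {n} Φ x = record
  { congruent   = λ X≋Y → congruent (cons-≋ (λ _ → refl) X≋Y)
  ; linear      = λ i α β XY XZ eq → linear (suc i) α β (agree XY) (agree XZ) eq
  ; alternating = λ a eq → alternating (there a) eq
  }
  where
  open AltForm Φ
  agree : ∀ {i : Fin m} {X Y : Family m n} → AgreeOff i X Y → AgreeOff (suc i) (x ∷ X) (x ∷ Y)
  agree XY zero _ _ = refl
  agree XY (suc j) j≢i = XY j (j≢i ∘ cong suc)

module _ {m n} {F : Family (suc m) n → ℤ} (Φ : AltForm F) where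
  open AltForm Φ

  linear-head : ∀ α β {x y z : Fin n → ℤ} {X : Family m n} →
    (∀ t → x t ≡ α * y t + β * z t) → F (x ∷ X) ≡ α * F (y ∷ X) + β * F (z ∷ X)
  linear-head α β = linear zero α β off off
    where
    off : ∀ {x y : Fin n → ℤ} {X : Family m n} → AgreeOff zero (x ∷ X) (y ∷ X)
    off zero 0≢0 = contradiction refl 0≢0
    off (suc j) _ _ = refl

  comb-head : ∀ {k} (c : Fin k → ℤ) (R : Family k n) (X : Family m n) →
    F (comb c R ∷ X) ≡ sumℤ (λ i → c i * F (R i ∷ X))
  -- The empty combination is the zero vector, written as `0ℤ` times itself twice, so the form
  -- vanishes on it.
  comb-head {zero} c R X = linear-head 0ℤ 0ℤ {y = λ _ → 0ℤ} {z = λ _ → 0ℤ} (λ _ → refl)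
  comb-head {suc k} c R X =
    trans (linear-head (c zero) 1ℤ (λ t → cong (c zero * R zero t +_) (sym (*-identityˡ _))))
          (cong (c zero * F (R zero ∷ X) +_) (trans (*-identityˡ _) (comb-head (c ∘ suc) (R ∘ suc) X)))

-- Polarisation: expand `F` with `s = x + y` in both leading places, where it vanishes, as it does
-- with `x` or with `y` in both.
swap-head : ∀ {m n} {F : Family (suc (suc m)) n → ℤ} → AltForm F →
  ∀ x y X → F (x ∷ y ∷ X) ≡ - F (y ∷ x ∷ X)
swap-head {m} {n} {F} Φ x y X = begin
  F (x ∷ y ∷ X)
    ≡⟨ rearrange (F (x ∷ x ∷ X)) (F (x ∷ y ∷ X)) (F (y ∷ x ∷ X)) (F (y ∷ y ∷ X)) ⟩
  (1ℤ * (1ℤ * F (x ∷ x ∷ X) + 1ℤ * F (x ∷ y ∷ X)) + 1ℤ * (1ℤ * F (y ∷ x ∷ X) + 1ℤ * F (y ∷ y ∷ X)))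
    - F (x ∷ x ∷ X) - F (y ∷ y ∷ X) - F (y ∷ x ∷ X)
    ≡⟨ cong (λ a → a - F (x ∷ x ∷ X) - F (y ∷ y ∷ X) - F (y ∷ x ∷ X)) expand ⟨
  F (s ∷ s ∷ X) - F (x ∷ x ∷ X) - F (y ∷ y ∷ X) - F (y ∷ x ∷ X)
    ≡⟨ cong₂ (λ a b → a - b - F (y ∷ y ∷ X) - F (y ∷ x ∷ X)) (double s) (double x) ⟩
  0ℤ - 0ℤ - F (y ∷ y ∷ X) - F (y ∷ x ∷ X)
    ≡⟨ cong (λ b → 0ℤ - 0ℤ - b - F (y ∷ x ∷ X)) (double y) ⟩
  0ℤ - 0ℤ - 0ℤ - F (y ∷ x ∷ X)
    ≡⟨ +-identityˡ _ ⟩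
  - F (y ∷ x ∷ X) ∎
  where
  s : Fin n → ℤ
  s t = 1ℤ * x t + 1ℤ * y t
  double : ∀ z → F (z ∷ z ∷ X) ≡ 0ℤ
  double z = AltForm.alternating Φ here (λ _ → refl)
  rearrange : ∀ a b c d → b ≡ (1ℤ * (1ℤ * a + 1ℤ * b) + 1ℤ * (1ℤ * c + 1ℤ * d)) - a - d - c
  rearrange = solve-∀
  expand : F (s ∷ s ∷ X) ≡
    1ℤ * (1ℤ * F (x ∷ x ∷ X) + 1ℤ * F (x ∷ y ∷ X)) + 1ℤ * (1ℤ * F (y ∷ x ∷ X) + 1ℤ * F (y ∷ y ∷ X))
  expand = trans (linear-head Φ 1ℤ 1ℤ (λ _ → refl))
    (cong₂ (λ a b → 1ℤ * a + 1ℤ * b)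
      (linear-head (cons-form Φ x) 1ℤ 1ℤ (λ _ → refl))
      (linear-head (cons-form Φ y) 1ℤ 1ℤ (λ _ → refl)))

-- Bringing member `k` to the front passes `k` neighbours, each exchange costing a sign by
-- `swap-head`.
rotate : ∀ {m n} {F : Family (suc m) n → ℤ} → AltForm F → (k : Fin (suc m)) (R : Family (suc m) n) →
  F (R k ∷ R ∘ punchIn k) ≡ sign (toℕ k) * F R
rotate {F = F} Φ zero R =
  trans (AltForm.congruent Φ (λ i t → sym (cons-η R i t))) (sym (*-identityˡ _))
rotate {suc m} {F = F} Φ (suc k) R = begin
  F (R (suc k) ∷ R ∘ punchIn (suc k))
    ≡⟨ AltForm.congruent Φ (cons-≋ (λ _ → refl) (cons-η _)) ⟩
  F (R (suc k) ∷ R zero ∷ R ∘ suc ∘ punchIn k)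
    ≡⟨ swap-head Φ _ _ _ ⟩
  - F (R zero ∷ R (suc k) ∷ R ∘ suc ∘ punchIn k)
    ≡⟨ cong -_ (rotate (cons-form Φ (R zero)) k (R ∘ suc)) ⟩
  - (sign (toℕ k) * F (R zero ∷ R ∘ suc))
    ≡⟨ ℤₚ.neg-distribˡ-* (sign (toℕ k)) _ ⟩
  - sign (toℕ k) * F (R zero ∷ R ∘ suc)
    ≡⟨ cong₂ _*_ (sym (sign-suc (toℕ k))) (AltForm.congruent Φ (λ i t → sym (cons-η R i t))) ⟩
  sign (suc (toℕ k)) * F R ∎

sign-cancel : ∀ k {x} → sign k * x ≡ 0ℤ → x ≡ 0ℤ
sign-cancel k {x} eq = begin
  x                       ≡⟨ *-identityˡ x ⟨
  1ℤ * x                  ≡⟨ cong (_* x) (sign-square k) ⟨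
  sign k * sign k * x     ≡⟨ *-assoc (sign k) _ x ⟩
  sign k * (sign k * x)   ≡⟨ cong (sign k *_) eq ⟩
  sign k * 0ℤ             ≡⟨ *-zeroʳ (sign k) ⟩
  0ℤ ∎

repeated-head : ∀ {m n} {F : Family (suc m) n → ℤ} → AltForm F →
  ∀ x (X : Family m n) i → (∀ t → X i t ≡ x t) → F (x ∷ X) ≡ 0ℤ
repeated-head {suc m} Φ x X i eq = sign-cancel (toℕ i)
  (trans (sym (rotate (cons-form Φ x) i X)) (AltForm.alternating Φ here (λ t → sym (eq t))))

repeated : ∀ {m n} {F : Family m n → ℤ} → AltForm F →
  ∀ (X : Family m n) {i j} → i ≢ j → (∀ t → X i t ≡ X j t) → F X ≡ 0ℤ
repeated Φ X {zero} {zero} i≢j eq = contradiction refl i≢j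
repeated Φ X {zero} {suc j} i≢j eq =
  trans (AltForm.congruent Φ (cons-η X)) (repeated-head Φ _ _ j (λ t → sym (eq t)))
repeated Φ X {suc i} {zero} i≢j eq =
  trans (AltForm.congruent Φ (cons-η X)) (repeated-head Φ _ _ i eq)
repeated Φ X {suc i} {suc j} i≢j eq =
  trans (AltForm.congruent Φ (cons-η X)) (repeated (cons-form Φ (X zero)) (X ∘ suc) (i≢j ∘ cong suc) eq)

-- By linearity each added multiple of `v` contributes a value of `H` with `v` among its members,
-- which is zero. In `form-comb`, `v` is the member already fixed in front.
shear : ∀ {m n} {H : Family m n → ℤ} → AltForm H → (v : Fin n → ℤ) →
  (∀ X i → (∀ t → X i t ≡ v t) → H X ≡ 0ℤ) →
  ∀ (c : Fin m → ℤ) X → H (λ i t → X i t + c i * v t) ≡ H X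
shear {zero} Φ v vanish c X = AltForm.congruent Φ (λ ())
shear {suc m} {n} {H} Φ v vanish c X = begin
  H X+cv
    ≡⟨ AltForm.congruent Φ (cons-η X+cv) ⟩
  H (X+cv zero ∷ X+cv ∘ suc)
    ≡⟨ linear-head Φ 1ℤ (c zero) (λ t → cong (_+ c zero * v t) (sym (*-identityˡ (X zero t)))) ⟩
  1ℤ * H (X zero ∷ X+cv ∘ suc) + c zero * H (v ∷ X+cv ∘ suc)
    ≡⟨ cong₂ (λ a b → a + c zero * b) (*-identityˡ (H (X zero ∷ X+cv ∘ suc))) (vanish (v ∷ X+cv ∘ suc) zero (λ _ → refl)) ⟩
  H (X zero ∷ X+cv ∘ suc) + c zero * 0ℤ
    ≡⟨ cong (H (X zero ∷ X+cv ∘ suc) +_) (*-zeroʳ (c zero)) ⟩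
  H (X zero ∷ X+cv ∘ suc) + 0ℤ
    ≡⟨ +-identityʳ _ ⟩
  H (X zero ∷ X+cv ∘ suc)
    ≡⟨ shear (cons-form Φ (X zero)) v (λ Y i → vanish (X zero ∷ Y) (suc i)) (c ∘ suc) (X ∘ suc) ⟩
  H (X zero ∷ X ∘ suc)
    ≡⟨ AltForm.congruent Φ (cons-η X) ⟨
  H X ∎
  where
  X+cv : Family (suc m) n
  X+cv i t = X i t + c i * v t

-- The source of both multiplicativity and transposition invariance of `det`. Expanding the first
-- combination puts `R k` in front; the multiples of `R k` in the later members shear away, and what
-- remains is the expansion of `det C` along row zero, with signs from `rotate`.
form-comb : ∀ {m n} {F : Family m n → ℤ} → AltForm F → (C : Mat ℤ m) (R : Family m n) →
  F (λ i → comb (C i) R) ≡ det C * F R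
form-comb {zero} Φ C R = trans (AltForm.congruent Φ (λ ())) (sym (*-identityˡ _))
form-comb {suc m} {n} {F} Φ C R = begin
  F (λ i → comb (C i) R)
    ≡⟨ AltForm.congruent Φ (cons-η _) ⟩
  F (comb (C zero) R ∷ λ i → comb (C (suc i)) R)
    ≡⟨ comb-head Φ (C zero) R _ ⟩
  sumℤ (λ k → C zero k * F (R k ∷ λ i → comb (C (suc i)) R))
    ≡⟨ sum-cong step ⟩
  sumℤ (λ k → sign (toℕ k) * (C zero k * det (minor k)) * F R)
    ≡⟨ sum-* (F R) (λ k → sign (toℕ k) * (C zero k * det (minor k))) ⟨
  det C * F R ∎
  where
  minor : Fin (suc m) → Mat ℤ m
  minor k i l = C (suc i) (punchIn k l)
  rearrange : ∀ a b s x → a * (b * (s * x)) ≡ s * (a * b) * x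
  rearrange = solve-∀
  step : ∀ k → C zero k * F (R k ∷ λ i → comb (C (suc i)) R) ≡
               sign (toℕ k) * (C zero k * det (minor k)) * F R
  step k = begin
    C zero k * F (R k ∷ λ i → comb (C (suc i)) R)
      ≡⟨ cong (C zero k *_) (AltForm.congruent Φ
           (cons-≋ (λ _ → refl) (λ i t → sum-punchIn k (λ l → C (suc i) l * R l t)))) ⟩
    C zero k * F (R k ∷ λ i t → comb (minor k i) (R ∘ punchIn k) t + C (suc i) k * R k t)
      ≡⟨ cong (C zero k *_)
           (shear (cons-form Φ (R k)) (R k) (repeated-head Φ (R k)) (λ i → C (suc i) k) _) ⟩
    C zero k * F (R k ∷ λ i → comb (minor k i) (R ∘ punchIn k))
      ≡⟨ cong (C zero k *_) (form-comb (cons-form Φ (R k)) (minor k) (R ∘ punchIn k)) ⟩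
    C zero k * (det (minor k) * F (R k ∷ R ∘ punchIn k))
      ≡⟨ cong (λ x → C zero k * (det (minor k) * x)) (rotate Φ k R) ⟩
    C zero k * (det (minor k) * (sign (toℕ k) * F R))
      ≡⟨ rearrange (C zero k) (det (minor k)) (sign (toℕ k)) (F R) ⟩
    sign (toℕ k) * (C zero k * det (minor k)) * F R ∎

-- Cramer's rule

module _ {m n} {F : Family m n → ℤ} (Φ : AltForm F) (i : Fin m) (X : Family m n) where

  private
    set : (Fin n → ℤ) → Family m n
    set x = updateAt X i (const x)

    off : ∀ x y → AgreeOff i (set x) (set y)
    off x y j j≢i t = cong (λ f → f t) (trans (updateAt-minimal j i X j≢i) (sym (updateAt-minimal j i X j≢i)))

    at : ∀ x t → set x i t ≡ x t
    at x t = cong (λ f → f t) (updateAt-updates i X)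

  linear-at : ∀ α β x y z → (∀ t → x t ≡ α * y t + β * z t) → F (set x) ≡ α * F (set y) + β * F (set z)
  linear-at α β x y z eq = AltForm.linear Φ i α β (off x y) (off x z)
    (λ t → trans (at x t) (trans (eq t) (sym (cong₂ (λ a b → α * a + β * b) (at y t) (at z t)))))

  linear-comb : ∀ {k} (c : Fin k → ℤ) (R : Family k n) → F (set (comb c R)) ≡ sumℤ (λ j → c j * F (set (R j)))
  linear-comb {zero} c R = linear-at 0ℤ 0ℤ _ (λ _ → 0ℤ) (λ _ → 0ℤ) (λ _ → refl)
  linear-comb {suc k} c R =
    trans (linear-at (c zero) 1ℤ _ (R zero) (comb (c ∘ suc) (R ∘ suc))
            (λ t → cong (c zero * R zero t +_) (sym (*-identityˡ _))))
          (cong (c zero * F (set (R zero)) +_) (trans (*-identityˡ _) (linear-comb (c ∘ suc) (R ∘ suc))))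

-- When the replaced member is expanded, every `X j` with `j ≢ i` repeats another member; only `u i`
-- times the original value survives.
cramer : ∀ {m n} {F : Family m n → ℤ} → AltForm F → ∀ (X : Family m n) (u : Fin m → ℤ) i →
  F (updateAt X i (const (comb u X))) ≡ u i * F X
cramer {F = F} Φ X u i = begin
  F (updateAt X i (const (comb u X)))
    ≡⟨ linear-comb Φ i X u X ⟩
  sumℤ (λ j → u j * F (updateAt X i (const (X j))))
    ≡⟨ sum-single i _ (λ j j≢i → trans (cong (u j *_) (double j j≢i)) (*-zeroʳ (u j))) ⟩
  u i * F (updateAt X i (const (X i)))
    ≡⟨ cong (u i *_) (AltForm.congruent Φ (λ j t → cong (λ f → f t) (same j))) ⟩
  u i * F X ∎
  where
  double : ∀ j → j ≢ i → F (updateAt X i (const (X j))) ≡ 0ℤ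
  double j j≢i = repeated Φ _ j≢i (λ t → cong (λ f → f t)
    (trans (updateAt-minimal j i X j≢i) (sym (updateAt-updates i X))))
  same : ∀ j → updateAt X i (const (X i)) j ≡ X j
  same j with j Fin.≟ i
  ... | yes refl = updateAt-updates i X
  ... | no j≢i   = updateAt-minimal j i X j≢i

-- The determinant as an alternating form of its columns

det-cong : ∀ {n} {A B : Mat ℤ n} → A ≋ B → det A ≡ det B
det-cong {zero} A≋B = refl
det-cong {suc n} A≋B = sum-cong (λ j → cong (sign (toℕ j) *_)
  (cong₂ _*_ (A≋B zero j) (det-cong (λ i k → A≋B (suc i) (punchIn j k)))))

-- Columns are taken as the members because `det` expands along row zero: each term then consists of
-- one entry of one member and a minor from which that member is absent.
detCols : ∀ {n} → Family n n → ℤ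
detCols X = det (λ i j → X j i)

-- In the term of `i` the entry is linear and the minor does not see member `i`; in every other term
-- the minor is linear by induction, at position `punchOut j≢i`.
detCols-linear : ∀ {n} (i : Fin n) α β {X Y Z : Family n n} → AgreeOff i X Y → AgreeOff i X Z →
  (∀ t → X i t ≡ α * Y i t + β * Z i t) → detCols X ≡ α * detCols Y + β * detCols Z
detCols-linear {suc n} i α β {X} {Y} {Z} XY XZ eq =
  trans (sum-cong term) (sum-linear α β
    (λ j → sign (toℕ j) * (Y j zero * detCols (minor Y j))) (λ j → sign (toℕ j) * (Z j zero * detCols (minor Z j))))
  where
  minor : Family (suc n) (suc n) → Fin (suc n) → Family n n
  minor W j k t = W (punchIn j k) (suc t)
  term : ∀ j → sign (toℕ j) * (X j zero * detCols (minor X j)) ≡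
    α * (sign (toℕ j) * (Y j zero * detCols (minor Y j))) + β * (sign (toℕ j) * (Z j zero * detCols (minor Z j)))
  term j with j Fin.≟ i
  ... | yes refl = begin
    sign (toℕ j) * (X j zero * detCols (minor X j))
      ≡⟨ cong (λ x → sign (toℕ j) * (x * detCols (minor X j))) (eq zero) ⟩
    sign (toℕ j) * ((α * Y j zero + β * Z j zero) * detCols (minor X j))
      ≡⟨ rearrange (sign (toℕ j)) α (Y j zero) β (Z j zero) (detCols (minor X j)) ⟩
    α * (sign (toℕ j) * (Y j zero * detCols (minor X j))) + β * (sign (toℕ j) * (Z j zero * detCols (minor X j)))
      ≡⟨ cong₂ (λ a b → α * (sign (toℕ j) * (Y j zero * a)) + β * (sign (toℕ j) * (Z j zero * b)))
           (det-cong (λ t k → XY (punchIn j k) (punchInᵢ≢i j k) (suc t)))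
           (det-cong (λ t k → XZ (punchIn j k) (punchInᵢ≢i j k) (suc t))) ⟩
    _ ∎
    where
    rearrange : ∀ s a y b z d → s * ((a * y + b * z) * d) ≡ a * (s * (y * d)) + b * (s * (z * d))
    rearrange = solve-∀
  ... | no j≢i = begin
    sign (toℕ j) * (X j zero * detCols (minor X j))
      ≡⟨ cong (λ d → sign (toℕ j) * (X j zero * d))
           (detCols-linear i′ α β (off XY) (off XZ) (λ t → subst
             (λ l → X l (suc t) ≡ α * Y l (suc t) + β * Z l (suc t)) (sym i′≡) (eq (suc t)))) ⟩
    sign (toℕ j) * (X j zero * (α * detCols (minor Y j) + β * detCols (minor Z j)))
      ≡⟨ rearrange (sign (toℕ j)) (X j zero) α (detCols (minor Y j)) β (detCols (minor Z j)) ⟩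
    α * (sign (toℕ j) * (X j zero * detCols (minor Y j))) + β * (sign (toℕ j) * (X j zero * detCols (minor Z j)))
      ≡⟨ cong₂ (λ y z → α * (sign (toℕ j) * (y * detCols (minor Y j))) + β * (sign (toℕ j) * (z * detCols (minor Z j))))
           (XY j j≢i zero) (XZ j j≢i zero) ⟩
    _ ∎
    where
    i′ : Fin n
    i′ = punchOut j≢i
    i′≡ : punchIn j i′ ≡ i
    i′≡ = punchIn-punchOut j≢i
    off : ∀ {W} → AgreeOff i X W → AgreeOff i′ (minor X j) (minor W j)
    off XW k k≢i′ t = XW (punchIn j k) (λ eq → k≢i′ (punchIn-injective j k i′ (trans eq (sym i′≡)))) (suc t)
    rearrange : ∀ s x a y b z → s * (x * (a * y + b * z)) ≡ a * (s * (x * y)) + b * (s * (x * z))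
    rearrange = solve-∀

-- The terms of `i` and `j` have equal entries and minors but opposite signs; all other minors still
-- contain the two equal neighbours.
detCols-alternating : ∀ {n} {i j : Fin n} → Adjacent i j → ∀ {X : Family n n} →
  (∀ t → X i t ≡ X j t) → detCols X ≡ 0ℤ
detCols-alternating {suc n} {i} {j} a {X} eq = sum-adjacent a term cancel vanish
  where
  minor : Fin (suc n) → Family n n
  minor l k t = X (punchIn l k) (suc t)
  term : Fin (suc n) → ℤ
  term l = sign (toℕ l) * (X l zero * detCols (minor l))
  minors : minor j ≋ minor i
  minors k t with punchIn-swap a k
  ... | inj₁ same = cong (λ l → X l (suc t)) (sym same)
  ... | inj₂ (i↦j , j↦i) = begin
    X (punchIn j k) (suc t) ≡⟨ cong (λ l → X l (suc t)) j↦i ⟩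
    X i (suc t)             ≡⟨ eq (suc t) ⟩
    X j (suc t)             ≡⟨ cong (λ l → X l (suc t)) i↦j ⟨
    X (punchIn i k) (suc t) ∎
  opposite : ∀ s x → s * x + - s * x ≡ 0ℤ
  opposite = solve-∀
  cancel : term i + term j ≡ 0ℤ
  cancel = trans
    (cong₂ (λ s p → term i + s * p) (sign-adjacent a)
      (cong₂ _*_ (sym (eq zero)) (det-cong (λ t k → minors k t))))
    (opposite (sign (toℕ i)) (X i zero * detCols (minor i)))
  vanish : ∀ k → k ≢ i → k ≢ j → term k ≡ 0ℤ
  vanish k k≢i k≢j with punchIn-adjacent a k k≢i k≢j
  ... | i′ , j′ , a′ , i≡ , j≡ = begin
    term k
      ≡⟨ cong (λ d → sign (toℕ k) * (X k zero * d)) (detCols-alternating a′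
           (λ t → trans (cong (λ l → X l (suc t)) i≡) (trans (eq (suc t)) (cong (λ l → X l (suc t)) (sym j≡))))) ⟩
    sign (toℕ k) * (X k zero * 0ℤ)
      ≡⟨ cong (sign (toℕ k) *_) (*-zeroʳ (X k zero)) ⟩
    sign (toℕ k) * 0ℤ
      ≡⟨ *-zeroʳ (sign (toℕ k)) ⟩
    0ℤ ∎

detCols-form : ∀ {n} → AltForm {n} {n} detCols
detCols-form = record
  { congruent   = λ X≋Y → det-cong (λ i j → X≋Y j i)
  ; linear      = detCols-linear
  ; alternating = detCols-alternating
  }

id-diag : ∀ {n} (i : Fin n) → idℤ i i ≡ 1ℤ
id-diag i with i Fin.≟ i
... | yes _ = refl
... | no i≢i = contradiction refl i≢i

id-off : ∀ {n} {i j : Fin n} → i ≢ j → idℤ i j ≡ 0ℤ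
id-off {i = i} {j} i≢j with i Fin.≟ j
... | yes i≡j = contradiction i≡j i≢j
... | no _ = refl

id-suc : ∀ {n} (i j : Fin n) → idℤ (suc i) (suc j) ≡ idℤ i j
id-suc i j with i Fin.≟ j
... | yes refl = refl
... | no _ = refl

sum-idˡ : ∀ {n} (i : Fin n) (f : Fin n → ℤ) → sumℤ (λ k → idℤ i k * f k) ≡ f i
sum-idˡ i f = trans
  (sum-single i _ (λ k k≢i → trans (cong (_* f k) (id-off (k≢i ∘ sym))) (*-zeroˡ (f k))))
  (trans (cong (_* f i) (id-diag i)) (*-identityˡ _))

sum-idʳ : ∀ {n} (j : Fin n) (f : Fin n → ℤ) → sumℤ (λ k → f k * idℤ k j) ≡ f j
sum-idʳ j f = trans
  (sum-single j _ (λ k k≢j → trans (cong (f k *_) (id-off k≢j)) (*-zeroʳ (f k))))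
  (trans (cong (f j *_) (id-diag j)) (*-identityʳ _))

det-id : ∀ {n} → det (idℤ {n}) ≡ 1ℤ
det-id {zero} = refl
det-id {suc n} = begin
  det (idℤ {suc n})
    ≡⟨ sum-single zero (λ j → sign (toℕ j) * (idℤ zero j * det (minor j)))
           (λ { zero 0≢0 → contradiction refl 0≢0 ; (suc j) _ → *-zeroʳ (sign (suc (toℕ j))) }) ⟩
  1ℤ * (1ℤ * det (minor zero))
    ≡⟨ trans (*-identityˡ (1ℤ * det (minor zero))) (*-identityˡ (det (minor zero))) ⟩
  det (minor zero)
    ≡⟨ det-cong {n} {minor zero} {idℤ} id-suc ⟩
  det (idℤ {n})
    ≡⟨ det-id {n} ⟩
  1ℤ ∎
  where
  minor : Fin (suc n) → Mat ℤ n
  minor j i k = idℤ (suc i) (punchIn j k)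

-- Evaluating the form detCols on C = C·I.
det-transpose : ∀ {n} (C : Mat ℤ n) → det (λ i j → C j i) ≡ det C
det-transpose {n} C = begin
  detCols C
    ≡⟨ det-cong (λ i j → sum-idʳ i (C j)) ⟨
  detCols (λ i → comb (C i) idℤ)
    ≡⟨ form-comb detCols-form C idℤ ⟩
  det C * detCols (idℤ {n})
    ≡⟨ cong (det C *_) (trans (det-cong {n} {λ i j → idℤ j i} {idℤ} (λ i j → id-sym j i)) (det-id {n})) ⟩
  det C * 1ℤ
    ≡⟨ *-identityʳ _ ⟩
  det C ∎
  where
  id-sym : ∀ {n} (i j : Fin n) → idℤ i j ≡ idℤ j i
  id-sym i j with i Fin.≟ j
  ... | yes refl = sym (id-diag i)
  ... | no i≢j = sym (id-off (i≢j ∘ sym))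

-- Kernels modulo a prime

∣-sum : ∀ {n d} {f : Fin n → ℤ} → (∀ i → d ∣ f i) → d ∣ sumℤ f
∣-sum {zero} {d} d∣f = divides 0ℤ (sym (*-zeroˡ d))
∣-sum {suc n} d∣f = ∣m∣n⇒∣m+n (d∣f zero) (∣-sum (d∣f ∘ suc))

∣-resp : ∀ {d x y} → x ≡ y → d ∣ x → d ∣ y
∣-resp eq = subst (_ ∣_) eq

∣0 : ∀ {d} → d ∣ 0ℤ
∣0 {d} = divides 0ℤ (sym (*-zeroˡ d))

module _ {p : ℕ} (p-prime : Prime p) where

  prime-∤1 : ¬ (pos p ∣ 1ℤ)
  prime-∤1 p∣1 = ¬prime[1] (subst Prime (ℕDiv.∣1⇒≡1 (∣⇒∣ᵤ p∣1)) p-prime)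

  euclid : ∀ a b → pos p ∣ a * b → pos p ∣ a ⊎ pos p ∣ b
  euclid a b p∣ab = Sum.map ∣ᵤ⇒∣ ∣ᵤ⇒∣
    (euclidsLemma ℤ.∣ a ∣ ℤ.∣ b ∣ p-prime (subst (p ℕDiv.∣_) (ℤₚ.abs-* a b) (∣⇒∣ᵤ p∣ab)))

  euclid-∤ : ∀ a b → ¬ (pos p ∣ a) → pos p ∣ a * b → pos p ∣ b
  euclid-∤ a b p∤a p∣ab = [ (λ p∣a → contradiction p∣a p∤a) , (λ p∣b → p∣b) ]′ (euclid a b p∣ab)

  power-cancel : ∀ k a b → ¬ (pos p ∣ a) → pos p ^ k ∣ a * b → pos p ^ k ∣ b
  power-cancel zero a b p∤a _ = divides b (sym (*-identityʳ b))
  power-cancel (suc k) a b p∤a pᵏ⁺¹∣ab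
    with euclid-∤ a b p∤a (∣-trans (∣m⇒∣m*n (pos p ^ k) ∣-refl) pᵏ⁺¹∣ab)
  ... | divides b′ refl = ∣-resp (*-comm (pos p) b′) (*-monoʳ-∣ (pos p)
        (power-cancel k a b′ p∤a (*-cancelˡ-∣ (pos p) {{prime⇒nonZero p-prime}} (∣-resp (rearrange a b′ (pos p)) pᵏ⁺¹∣ab))))
    where
    rearrange : ∀ a b p → a * (b * p) ≡ p * (a * b)
    rearrange = solve-∀

-- For `d = pos p` with `p` prime this is linear independence over the field with `p` elements.
Independent : ∀ {k m} → ℤ → Family k m → Set
Independent d U = ∀ c → (∀ t → d ∣ comb c U t) → ∀ j → d ∣ c j

unit-entry : ∀ {m p} → (u : Fin m → ℤ) → ¬ (∀ i → pos p ∣ u i) → ∃ λ i → ¬ (pos p ∣ u i)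
unit-entry {m} {p} u u≢0 = ¬∀⟶∃¬ m (λ i → pos p ∣ u i) (λ i → pos p ∣? u i) u≢0

-- Cramer's rule with the factor `d` taken out of the replaced member. Keeping the quotient visible
-- is what lets `independent-kernel` iterate.
cramer-∣ : ∀ {m n} {F : Family m n → ℤ} (Φ : AltForm F) (X : Family m n) (u : Fin m → ℤ) {d} i →
  (d∣ : ∀ t → d ∣ comb u X t) → u i * F X ≡ d * F (updateAt X i (const (_∣_.quotient ∘ d∣)))
cramer-∣ {F = F} Φ X u {d} i d∣ = begin
  u i * F X                         ≡⟨ cramer Φ X u i ⟨
  F (updateAt X i (const (comb u X))) ≡⟨ linear-at Φ i X d 0ℤ _ q q quotient-eq ⟩
  d * F X′ + 0ℤ * F X′              ≡⟨ drop d (F X′) ⟩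
  d * F X′ ∎
  where
  q = _∣_.quotient ∘ d∣
  X′ = updateAt X i (const q)
  drop : ∀ a b → a * b + 0ℤ * b ≡ a * b
  drop = solve-∀
  quotient-eq : ∀ t → comb u X t ≡ d * q t + 0ℤ * q t
  quotient-eq t = trans (_∣_.equality (d∣ t)) (trans (*-comm (q t) d) (sym (drop d (q t))))

-- Used with `d` equal to 2, to p² and to `0ℤ`; in the last case divisibility says that the product
-- is zero.
∣-cramer : ∀ {m n} {F : Family m n → ℤ} (Φ : AltForm F) (X : Family m n) (u : Fin m → ℤ) {d} i →
  (∀ t → d ∣ comb u X t) → d ∣ u i * F X
∣-cramer Φ X u i d∣ = ∣-resp (sym (cramer-∣ Φ X u i d∣)) (∣m⇒∣m*n _ ∣-refl)

-- Pivot on an entry of U 0 that is prime to p: replacing the corresponding member of X by (comb (U 0) X) / p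
-- divides F X by p up to a unit, and eliminating that entry from the other U j keeps their hypotheses.
independent-kernel : ∀ {p} → Prime p → ∀ {k m n} {F : Family m n → ℤ} → AltForm F →
  (X : Family m n) (U : Family k m) → Independent (pos p) U →
  (∀ j t → pos p ∣ comb (U j) X t) → pos p ^ k ∣ F X
independent-kernel p-prime {zero} {F = F} Φ X U ind ker = divides (F X) (sym (*-identityʳ (F X)))
independent-kernel {p} p-prime {suc k} {m} {n} {F} Φ X U ind ker
  -- If `U zero` vanished modulo `p`, the coefficients `idℤ zero` would form a dependency with an
  -- entry 1.
  with unit-entry (U zero) (λ p∣u → prime-∤1 p-prime
         (ind (idℤ zero) (λ t → ∣-resp (sym (sum-idˡ zero (λ j → U j t))) (p∣u t)) zero))
... | i , p∤uᵢ = power-cancel p-prime (suc k) (U zero i) (F X) p∤uᵢ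
        (∣-resp (sym reduce) (*-monoʳ-∣ (pos p) (independent-kernel p-prime Φ X′ U′ ind′ ker′)))
  where
  q : Fin n → ℤ
  q t = _∣_.quotient (ker zero t)

  X′ : Family m n
  X′ = updateAt X i (const q)

  U′ : Family k m
  U′ j t = U zero i * U (suc j) t + - U (suc j) i * U zero t

  reduce : U zero i * F X ≡ pos p * F X′
  reduce = cramer-∣ Φ X (U zero) i (ker zero)

  U′ᵢ≡0 : ∀ j → U′ j i ≡ 0ℤ
  U′ᵢ≡0 j = cancel (U zero i) (U (suc j) i)
    where
    cancel : ∀ a b → a * b + - b * a ≡ 0ℤ
    cancel = solve-∀

  comb-U′ : ∀ j t → comb (U′ j) X′ t ≡ U zero i * comb (U (suc j)) X t + - U (suc j) i * comb (U zero) X t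
  comb-U′ j t = trans (sum-cong term)
    (sum-linear (U zero i) (- U (suc j) i) (λ l → U (suc j) l * X l t) (λ l → U zero l * X l t))
    where
    expand : ∀ a b c d x → (a * b + c * d) * x ≡ a * (b * x) + c * (d * x)
    expand = solve-∀
    term : ∀ l → U′ j l * X′ l t ≡ U zero i * (U (suc j) l * X l t) + - U (suc j) i * (U zero l * X l t)
    term l = trans swapX (expand (U zero i) (U (suc j) l) (- U (suc j) i) (U zero l) (X l t))
      where
      swapX : U′ j l * X′ l t ≡ U′ j l * X l t
      swapX with l Fin.≟ i
      -- `X′` differs from `X` only at `i`, where the coefficient has been eliminated.
      ... | yes refl = trans (cong (_* X′ l t) (U′ᵢ≡0 j)) (sym (cong (_* X l t) (U′ᵢ≡0 j)))
      ... | no l≢i = cong (λ x → U′ j l * x t) (updateAt-minimal l i X l≢i)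

  ker′ : ∀ j t → pos p ∣ comb (U′ j) X′ t
  ker′ j t = ∣-resp (sym (comb-U′ j t))
    (∣m∣n⇒∣m+n (∣n⇒∣m*n (U zero i) (ker (suc j) t)) (∣n⇒∣m*n (- U (suc j) i) (ker zero t)))

  ind′ : Independent (pos p) U′
  ind′ c p∣cU′ j = euclid-∤ p-prime (U zero i) (c j) p∤uᵢ (ind c″ (λ t → ∣-resp (sym (comb-c″ t)) (p∣cU′ t)) (suc j))
    where
    s : ℤ
    s = sumℤ (λ j → c j * U (suc j) i)
    -- The same combination in terms of `U`: the multiples of `U zero` subtracted in the `U′ j`
    -- collect to `- s`.
    c″ : Fin (suc k) → ℤ
    c″ = (- s) ∷ λ j → U zero i * c j
    comb-c″ : ∀ t → comb c″ U t ≡ comb c U′ t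
    comb-c″ t = begin
      - s * U zero t + sumℤ (λ j → U zero i * c j * U (suc j) t)
        ≡⟨ cong (- s * U zero t +_) (trans (sum-cong (λ j → *-assoc (U zero i) (c j) (U (suc j) t)))
             (sym (*-sum (U zero i) (λ j → c j * U (suc j) t)))) ⟩
      - s * U zero t + U zero i * sumℤ (λ j → c j * U (suc j) t)
        ≡⟨ rearrange s (U zero t) (U zero i) (sumℤ (λ j → c j * U (suc j) t)) ⟩
      U zero i * sumℤ (λ j → c j * U (suc j) t) + - U zero t * s
        ≡⟨ sum-linear (U zero i) (- U zero t) (λ j → c j * U (suc j) t) (λ j → c j * U (suc j) i) ⟨
      sumℤ (λ j → U zero i * (c j * U (suc j) t) + - U zero t * (c j * U (suc j) i))
        ≡⟨ sum-cong (λ j → collect (U zero i) (c j) (U (suc j) t) (U zero t) (U (suc j) i)) ⟩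
      comb c U′ t ∎
      where
      rearrange : ∀ s u v x → - s * u + v * x ≡ v * x + - u * s
      rearrange = solve-∀
      collect : ∀ u c x v y → u * (c * x) + - v * (c * y) ≡ c * (u * x + - y * v)
      collect = solve-∀

-- Walk vectors and the prime 2

dot : ∀ {n} → (Fin n → ℤ) → (Fin n → ℤ) → ℤ
dot x y = sumℤ (λ i → x i * y i)

dot-comm : ∀ {n} (x y : Fin n → ℤ) → dot x y ≡ dot y x
dot-comm x y = sum-cong (λ i → *-comm (x i) (y i))

dot-cong : ∀ {n} {x x′ y y′ : Fin n → ℤ} → (∀ i → x i ≡ x′ i) → (∀ i → y i ≡ y′ i) → dot x y ≡ dot x′ y′
dot-cong x≗ y≗ = sum-cong (λ i → cong₂ _*_ (x≗ i) (y≗ i))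

dot-congˡ : ∀ {n} {x x′ : Fin n → ℤ} y → (∀ i → x i ≡ x′ i) → dot x y ≡ dot x′ y
dot-congˡ y x≗ = sum-cong (λ i → cong (_* y i) (x≗ i))

dot-congʳ : ∀ {n} (x : Fin n → ℤ) {y y′} → (∀ i → y i ≡ y′ i) → dot x y ≡ dot x y′
dot-congʳ x y≗ = sum-cong (λ i → cong (x i *_) (y≗ i))

dot-linear : ∀ {n} α β (x y z : Fin n → ℤ) → dot (λ i → α * x i + β * y i) z ≡ α * dot x z + β * dot y z
dot-linear α β x y z =
  trans (sum-cong (λ i → distrib α β (x i) (y i) (z i))) (sum-linear α β (λ i → x i * z i) (λ i → y i * z i))
  where
  distrib : ∀ α β x y z → (α * x + β * y) * z ≡ α * (x * z) + β * (y * z)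
  distrib = solve-∀

dot-comb : ∀ {k n} (c : Fin k → ℤ) (Z : Family k n) y → dot (comb c Z) y ≡ sumℤ (λ j → c j * dot (Z j) y)
dot-comb c Z y = begin
  sumℤ (λ i → comb c Z i * y i)
    ≡⟨ sum-cong (λ i → trans (sum-* (y i) (λ j → c j * Z j i)) (sum-cong (λ j → *-assoc (c j) (Z j i) (y i)))) ⟩
  sumℤ (λ i → sumℤ (λ j → c j * (Z j i * y i)))
    ≡⟨ sum-swap (λ i j → c j * (Z j i * y i)) ⟩
  sumℤ (λ j → sumℤ (λ i → c j * (Z j i * y i)))
    ≡⟨ sum-cong (λ j → sym (*-sum (c j) (λ i → Z j i * y i))) ⟩
  sumℤ (λ j → c j * dot (Z j) y) ∎

square-linear : ∀ {n} α β (x y : Fin n → ℤ) →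
  dot (λ i → α * x i + β * y i) (λ i → α * x i + β * y i) ≡
  α * α * dot x x + pos 2 * (α * β * dot x y) + β * β * dot y y
square-linear α β x y = begin
  dot w w ≡⟨ dot-linear α β x y w ⟩
  α * dot x w + β * dot y w ≡⟨ cong₂ (λ a b → α * a + β * b) (right x) (right y) ⟩
  α * (α * dot x x + β * dot y x) + β * (α * dot x y + β * dot y y)
    ≡⟨ cong (λ a → α * (α * dot x x + β * a) + β * (α * dot x y + β * dot y y)) (dot-comm y x) ⟩
  α * (α * dot x x + β * dot x y) + β * (α * dot x y + β * dot y y)
    ≡⟨ expand α β (dot x x) (dot x y) (dot y y) ⟩
  _ ∎
  where
  w = λ i → α * x i + β * y i
  right : ∀ z → dot z w ≡ α * dot x z + β * dot y z
  right z = trans (dot-comm z w) (dot-linear α β x y z)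
  expand : ∀ α β a b c → α * (α * a + β * b) + β * (α * b + β * c) ≡ α * α * a + pos 2 * (α * β * b) + β * β * c
  expand = solve-∀

matVec-cong : ∀ {n} (A : Mat ℤ n) {x y} → (∀ i → x i ≡ y i) → ∀ i → matVec A x i ≡ matVec A y i
matVec-cong A x≗y i = sum-cong (λ j → cong (A i j *_) (x≗y j))

matVec-comb : ∀ {k n} (A : Mat ℤ n) (c : Fin k → ℤ) (Z : Family k n) i →
  matVec A (comb c Z) i ≡ comb c (matVec A ∘ Z) i
matVec-comb A c Z i = trans (dot-comm (A i) (comb c Z))
  (trans (dot-comb c Z (A i)) (sum-cong (λ j → cong (c j *_) (dot-comm (Z j) (A i)))))

matVec-linear : ∀ {n} (A : Mat ℤ n) α β x y i →
  matVec A (λ j → α * x j + β * y j) i ≡ α * matVec A x i + β * matVec A y i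
matVec-linear A α β x y i = trans (dot-comm (A i) (λ j → α * x j + β * y j))
  (trans (dot-linear α β x y (A i)) (cong₂ (λ a b → α * a + β * b) (dot-comm x (A i)) (dot-comm y (A i))))

dot-adjoint : ∀ {n} (A : Mat ℤ n) x y → dot (matVec A x) y ≡ dot x (matVec (λ i j → A j i) y)
dot-adjoint A x y = begin
  sumℤ (λ i → matVec A x i * y i)
    ≡⟨ sum-cong (λ i → trans (sum-* (y i) (λ k → A i k * x k)) (sum-cong (λ k → rearrange (A i k) (x k) (y i)))) ⟩
  sumℤ (λ i → sumℤ (λ k → x k * (A i k * y i)))
    ≡⟨ sum-swap (λ i k → x k * (A i k * y i)) ⟩
  sumℤ (λ k → sumℤ (λ i → x k * (A i k * y i)))
    ≡⟨ sum-cong (λ k → sym (*-sum (x k) (λ i → A i k * y i))) ⟩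
  dot x (matVec (λ i j → A j i) y) ∎
  where
  rearrange : ∀ a x y → a * x * y ≡ x * (a * y)
  rearrange = solve-∀

2∣x²-x : ∀ x → pos 2 ∣ x * x - x
2∣x²-x (pos n) = go n
  where
  step : ∀ x → (1ℤ + x) * (1ℤ + x) - (1ℤ + x) ≡ (x * x - x) + pos 2 * x
  step = solve-∀
  go : ∀ n → pos 2 ∣ pos n * pos n - pos n
  go zero = ∣0
  go (suc n) = ∣-resp (sym (step (pos n))) (∣m∣n⇒∣m+n (go n) (∣m⇒∣m*n (pos n) ∣-refl))
2∣x²-x x@(-[1+ n ]) = ∣-resp (reflect (pos (suc n))) (∣m∣n⇒∣m+n (2∣x²-x (pos (suc n))) (∣m⇒∣m*n (pos (suc n)) ∣-refl))
  where
  reflect : ∀ x → (x * x - x) + pos 2 * x ≡ - x * - x - - x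
  reflect = solve-∀

∣-cong : ∀ {d x y} → d ∣ x - y → d ∣ y → d ∣ x
∣-cong {d} {x} {y} d∣x-y d∣y = ∣-resp (cancel x y) (∣m∣n⇒∣m+n d∣x-y d∣y)
  where
  cancel : ∀ x y → x - y + y ≡ x
  cancel = solve-∀

∣-cong′ : ∀ {d x y} → d ∣ x - y → d ∣ x → d ∣ y
∣-cong′ {d} {x} {y} d∣x-y d∣x = ∣-resp (cancel x y) (∣m∣n⇒∣m-n d∣x d∣x-y)
  where
  cancel : ∀ x y → x - (x - y) ≡ y
  cancel = solve-∀

sum-∣- : ∀ {n d} (f g : Fin n → ℤ) → (∀ i → d ∣ f i - g i) → d ∣ sumℤ f - sumℤ g
sum-∣- f g d∣ = ∣-resp (trans (sum-cong (λ i → expand (f i) (g i)))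
  (trans (sum-linear 1ℤ -1ℤ f g) (collect (sumℤ f) (sumℤ g)))) (∣-sum d∣)
  where
  expand : ∀ x y → x - y ≡ 1ℤ * x + -1ℤ * y
  expand = solve-∀
  collect : ∀ x y → 1ℤ * x + -1ℤ * y ≡ x - y
  collect = solve-∀

2∣*2∣ : ∀ {x y} → pos 2 ∣ x → pos 2 ∣ y → pos 4 ∣ x * y
2∣*2∣ {x} {y} (divides a refl) (divides b refl) = divides (a * b) (rearrange a b)
  where
  rearrange : ∀ a b → a * pos 2 * (b * pos 2) ≡ a * b * pos 4
  rearrange = solve-∀

-- Cross terms vanish modulo 4 because they occur twice, and c² ≡ c modulo 2.
square-comb : ∀ {r n} (c : Fin r → ℤ) (Z : Family r n) → (∀ a b → pos 2 ∣ dot (Z a) (Z b)) →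
  pos 4 ∣ dot (comb c Z) (comb c Z) - sumℤ (λ a → c a * dot (Z a) (Z a))
square-comb {zero} {n} c Z even = ∣-resp (sym (cong (_- 0ℤ) (sum-zero {n} (λ _ → refl)))) ∣0
square-comb {suc r} {n} c Z even = ∣-resp (sym eq)
  (∣m∣n⇒∣m+n (∣m∣n⇒∣m+n (2∣*2∣ (2∣x²-x c₀) (even zero zero)) (2∣*2∣ ∣-refl (∣n⇒∣m*n c₀ even-cross)))
             (square-comb (c ∘ suc) (Z ∘ suc) (λ a b → even (suc a) (suc b))))
  where
  c₀ = c zero
  V : Fin n → ℤ
  V = comb (c ∘ suc) (Z ∘ suc)
  Σ′ : ℤ
  Σ′ = sumℤ (λ a → c (suc a) * dot (Z (suc a)) (Z (suc a)))
  even-cross : pos 2 ∣ dot (Z zero) V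
  even-cross = ∣-resp (sym (trans (dot-comm (Z zero) V) (dot-comb (c ∘ suc) (Z ∘ suc) (Z zero))))
    (∣-sum (λ a → ∣n⇒∣m*n (c (suc a)) (even (suc a) zero)))
  unit : ∀ t → comb c Z t ≡ c₀ * Z zero t + 1ℤ * V t
  unit t = cong (c₀ * Z zero t +_) (sym (*-identityˡ (V t)))
  arrange : ∀ c A B D s → c * c * A + pos 2 * (c * 1ℤ * B) + 1ℤ * 1ℤ * D - (c * A + s) ≡
                          (c * c - c) * A + pos 2 * (c * B) + (D - s)
  arrange = solve-∀
  eq : dot (comb c Z) (comb c Z) - (c₀ * dot (Z zero) (Z zero) + Σ′) ≡
       (c₀ * c₀ - c₀) * dot (Z zero) (Z zero) + pos 2 * (c₀ * dot (Z zero) V) + (dot V V - Σ′)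
  eq = trans (cong (_- (c₀ * dot (Z zero) (Z zero) + Σ′)) (trans (dot-cong unit unit) (square-linear c₀ 1ℤ (Z zero) V)))
    (arrange c₀ (dot (Z zero) (Z zero)) (dot (Z zero) V) (dot V V) Σ′)

infix 4 _≈±_
_≈±_ : ℤ → ℤ → Set
x ≈± y = x ≡ y ⊎ x ≡ - y

neg-≈± : ∀ {x y} → x ≈± y → - x ≈± y
neg-≈± (inj₁ refl) = inj₂ refl
neg-≈± {y = y} (inj₂ refl) = inj₁ (ℤₚ.neg-involutive y)

sym-≈± : ∀ {x y} → x ≈± y → y ≈± x
sym-≈± (inj₁ eq) = inj₁ (sym eq)
sym-≈± {y = y} (inj₂ refl) = inj₂ (sym (ℤₚ.neg-involutive y))

≈±0 : ∀ {x y} → x ≈± y → y ≡ 0ℤ → x ≡ 0ℤ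
≈±0 (inj₁ eq) refl = eq
≈±0 (inj₂ eq) refl = eq

∣-≈± : ∀ {d x y} → x ≈± y → d ∣ y → d ∣ x
∣-≈± (inj₁ refl) d∣y = d∣y
∣-≈± (inj₂ refl) d∣y = ∣m⇒∣-m d∣y

-- For even `y` both signs agree modulo 4, since `2y` is a multiple of 4. This removes the signs
-- left by skew-symmetry.
≈±-mod4 : ∀ {x y} → x ≈± y → pos 2 ∣ y → pos 4 ∣ x - y
≈±-mod4 {x} (inj₁ refl) _ = ∣-resp (sym (+-inverseʳ x)) ∣0
≈±-mod4 (inj₂ refl) (divides q refl) = divides (- q) (rearrange q)
  where
  rearrange : ∀ q → - (q * pos 2) - q * pos 2 ≡ - q * pos 4
  rearrange = solve-∀

x≡-x⇒x≡0 : ∀ {x} → x ≡ - x → x ≡ 0ℤ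
x≡-x⇒x≡0 {pos zero} _ = refl

parity : ∀ m → (∃ λ k → m ≡ k ℕ.+ k) ⊎ (∃ λ k → m ≡ suc (k ℕ.+ k))
parity zero = inj₁ (0 , refl)
parity (suc m) with parity m
... | inj₁ (k , refl) = inj₂ (k , refl)
... | inj₂ (k , refl) = inj₁ (suc k , cong suc (sym (ℕₚ.+-suc k k)))

sum-1 : ∀ n → sumℤ {n} (λ _ → 1ℤ * 1ℤ) ≡ pos n
sum-1 zero = refl
sum-1 (suc n) = cong (1ℤ +_) (sum-1 n)

-- Coefficients go to even positions because the norm of the walk vector of index `k` is, up to
-- sign, the Gram entry of total index `2k`.
dbl : ∀ {r} → (Fin r → ℤ) → Fin (r ℕ.* 2) → ℤ
dbl {suc r} c zero = c zero
dbl {suc r} c (suc zero) = 0ℤ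
dbl {suc r} c (suc (suc k)) = dbl (c ∘ suc) k

sum-dbl : ∀ {r} (c : Fin r → ℤ) (f : ℕ → ℤ) →
  sumℤ (λ k → dbl c k * f (toℕ k)) ≡ sumℤ (λ a → c a * f (toℕ a ℕ.* 2))
sum-dbl {zero} c f = refl
sum-dbl {suc r} c f = cong (c zero * f 0 +_)
  (trans (+-identityˡ _) (sum-dbl (c ∘ suc) (λ k → f (suc (suc k)))))

dbl-∣ : ∀ {r d} (c : Fin r → ℤ) → (∀ k → d ∣ dbl c k) → ∀ a → d ∣ c a
dbl-∣ c d∣ zero = d∣ zero
dbl-∣ c d∣ (suc a) = dbl-∣ (c ∘ suc) (λ k → d∣ (suc (suc k))) a

form-scale : ∀ {m n} {F : Family m n → ℤ} → AltForm F → ∀ d X → F (λ k t → d * X k t) ≡ d ^ m * F X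
form-scale {zero} Φ d X = trans (AltForm.congruent Φ (λ ())) (sym (*-identityˡ _))
form-scale {suc m} {n} {F} Φ d X = begin
  F (λ k t → d * X k t)
    ≡⟨ AltForm.congruent Φ (cons-η _) ⟩
  F (dX zero ∷ dX ∘ suc)
    ≡⟨ linear-head Φ d 0ℤ {z = X zero} (λ t → sym (drop d (X zero t))) ⟩
  d * F (X zero ∷ dX ∘ suc) + 0ℤ * F (X zero ∷ dX ∘ suc)
    ≡⟨ drop d _ ⟩
  d * F (X zero ∷ dX ∘ suc)
    ≡⟨ cong (d *_) (form-scale (cons-form Φ (X zero)) d (X ∘ suc)) ⟩
  d * (d ^ m * F (X zero ∷ X ∘ suc))
    ≡⟨ *-assoc d (d ^ m) _ ⟨
  d ^ suc m * F (X zero ∷ X ∘ suc)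
    ≡⟨ cong (d ^ suc m *_) (AltForm.congruent Φ (cons-η X)) ⟨
  d ^ suc m * F X ∎
  where
  dX : Family (suc m) n
  dX k t = d * X k t
  drop : ∀ a b → a * b + 0ℤ * b ≡ a * b
  drop = solve-∀

-- The Gram matrix of the walk vectors

module Walks {n} (Σ′ : OrientedGraph n) where

  A : Mat ℤ n
  A = S Σ′

  w : ℕ → Fin n → ℤ
  w = walkVec A

  dot-skew : ∀ x y → dot (matVec A x) y ≡ - dot x (matVec A y)
  dot-skew x y = begin
    dot (matVec A x) y
      ≡⟨ dot-adjoint A x y ⟩
    dot x (matVec (λ i j → A j i) y)
      ≡⟨ sum-cong (λ i → cong (x i *_) (sum-cong (λ j → trans (cong (_* y j) (skew Σ′ i j)) (neg (A i j) (y j))))) ⟩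
    dot x (λ i → sumℤ (λ j → -1ℤ * (A i j * y j)))
      ≡⟨ sum-cong (λ i → trans (cong (x i *_) (sym (*-sum -1ℤ (λ j → A i j * y j)))) (pull (x i) (matVec A y i))) ⟩
    sumℤ (λ i → -1ℤ * (x i * matVec A y i))
      ≡⟨ *-sum -1ℤ (λ i → x i * matVec A y i) ⟨
    -1ℤ * dot x (matVec A y)
      ≡⟨ ℤₚ.-1*i≡-i _ ⟩
    - dot x (matVec A y) ∎
    where
    neg : ∀ a b → - a * b ≡ -1ℤ * (a * b)
    neg = solve-∀
    pull : ∀ a b → a * (-1ℤ * b) ≡ -1ℤ * (a * b)
    pull = solve-∀

  h : ℕ → ℕ → ℤ
  h j k = dot (w j) (w k)

  -- Skew-symmetry carries each power of `A` to the other factor at the cost of a sign, so up to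
  -- signs WᵀW is a Hankel matrix.
  h≈± : ∀ j k → h j k ≈± h 0 (j ℕ.+ k)
  h≈± zero k = inj₁ refl
  h≈± (suc j) k = subst (_≈± h 0 (suc (j ℕ.+ k))) (sym (dot-skew (w j) (w k)))
    (neg-≈± (subst (λ m → h j (suc k) ≈± h 0 m) (ℕₚ.+-suc j k) (h≈± j (suc k))))

  -- Up to sign this is the product of `w m` and `matVec A (w m)`, which equals its own negative.
  h-odd : ∀ m → h 0 (suc (m ℕ.+ m)) ≡ 0ℤ
  h-odd m = subst (λ l → h 0 l ≡ 0ℤ) (ℕₚ.+-suc m m)
    (≈±0 (sym-≈± (h≈± m (suc m))) (x≡-x⇒x≡0 (trans (dot-comm (w m) (w (suc m))) (dot-skew (w m) (w m)))))

  -- Strong induction: at odd indices the value is zero, and at `2k` it is up to sign the norm of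
  -- `w k`, congruent to `h 0 k` modulo 2 because squaring preserves parity. Index 0 is left out
  -- since `h 0 0` is `n`.
  h-even : ∀ m → pos 2 ∣ h 0 (suc m)
  h-even = <-rec (λ m → pos 2 ∣ h 0 (suc m)) step
    where
    square : ∀ k → pos 2 ∣ h k k - h 0 k
    square k = sum-∣- (λ i → w k i * w k i) (λ i → 1ℤ * w k i)
      (λ i → ∣-resp (cong (λ x → w k i * w k i - x) (sym (*-identityˡ (w k i)))) (2∣x²-x (w k i)))
    step : ∀ m → (∀ {k} → k ℕ.< m → pos 2 ∣ h 0 (suc k)) → pos 2 ∣ h 0 (suc m)
    step m rec with parity (suc m)
    ... | inj₂ (k , eq) = ∣-resp (sym (trans (cong (h 0) eq) (h-odd k))) ∣0
    ... | inj₁ (suc k , eq) = subst (λ l → pos 2 ∣ h 0 l) (sym eq)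
      (∣-≈± (sym-≈± (h≈± (suc k) (suc k))) (∣-cong {x = h (suc k) (suc k)} (square (suc k)) (rec k<m)))
      where
      k<m : k ℕ.< m
      k<m = subst (k ℕ.<_) (sym (ℕₚ.suc-injective eq)) (ℕₚ.m<m+n k (ℕ.s≤s ℕ.z≤n))

  pow : ℕ → (Fin n → ℤ) → Fin n → ℤ
  pow zero x = x
  pow (suc b) x = matVec A (pow b x)

  pow-w : ∀ b j → pow b (w j) ≡ w (b ℕ.+ j)
  pow-w zero j = refl
  pow-w (suc b) j = cong (matVec A) (pow-w b j)

  pow-cong : ∀ b {x y} → (∀ i → x i ≡ y i) → ∀ i → pow b x i ≡ pow b y i
  pow-cong zero x≗y = x≗y
  pow-cong (suc b) x≗y = matVec-cong A (pow-cong b x≗y)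

  pow-comb : ∀ b {k} (c : Fin k → ℤ) (Z : Family k n) i → pow b (comb c Z) i ≡ comb c (pow b ∘ Z) i
  pow-comb zero c Z i = refl
  pow-comb (suc b) c Z i = trans (matVec-cong A (pow-comb b c Z) i) (matVec-comb A c (pow b ∘ Z) i)

  pow-linear : ∀ b α β x y i → pow b (λ j → α * x j + β * y j) i ≡ α * pow b x i + β * pow b y i
  pow-linear zero α β x y i = refl
  pow-linear (suc b) α β x y i =
    trans (matVec-cong A (pow-linear b α β x y) i) (matVec-linear A α β (pow b x) (pow b y) i)

  W : Mat ℤ n
  W = walkMatrix Σ′

  detCols-W : detCols W ≡ det W
  detCols-W = det-transpose W

  gram : Family n n
  gram j k = h (toℕ j) (toℕ k)

  detCols-gram : detCols gram ≡ det W * det W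
  detCols-gram = trans (form-comb detCols-form (λ i k → W k i) W) (cong₂ _*_ (det-transpose W) detCols-W)

  module TwoPart (r : ℕ) (m : ℤ) (m-odd : ¬ (pos 2 ∣ m)) (detW : det W ≡ pos 2 ^ r * m) where

    cancel-2^ : ∀ k {a b} → pos 2 ^ k * a ≡ pos 2 ^ k * b → a ≡ b
    cancel-2^ zero {a} {b} eq = trans (sym (*-identityˡ a)) (trans eq (*-identityˡ b))
    cancel-2^ (suc k) {a} {b} eq = cancel-2^ k (ℤₚ.*-cancelˡ-≡ (pos 2) _ _
      (trans (sym (*-assoc (pos 2) (pos 2 ^ k) a)) (trans eq (*-assoc (pos 2) (pos 2 ^ k) b))))

    -- `F X` is det WᵀW = 2²ʳm², read as a form in the last `2r` columns. Halving these leaves `Y`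
    -- with `F Y = m²` odd, and `c` annihilates `Y` modulo 2, so Cramer's rule makes each `c k`
    -- even.
    nonsingular : ∀ {F : Family (r ℕ.* 2) n → ℤ} (Φ : AltForm F) (X : Family (r ℕ.* 2) n) →
      F X ≡ detCols gram → (∀ k t → pos 2 ∣ X k t) →
      ∀ c → (∀ t → pos 4 ∣ comb c X t) → ∀ k → pos 2 ∣ c k
    nonsingular {F} Φ X FX≡ even c 4∣ k =
      euclid-∤ prime[2] (F Y) (c k) FY-odd (∣-resp (*-comm (c k) (F Y)) (∣-cramer Φ Y c k 2∣cY))
      where
      Y : Family (r ℕ.* 2) n
      Y k t = _∣_.quotient (even k t)
      X≡2Y : ∀ k t → X k t ≡ pos 2 * Y k t
      X≡2Y k t = trans (_∣_.equality (even k t)) (*-comm (Y k t) (pos 2))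
      2∣cY : ∀ t → pos 2 ∣ comb c Y t
      2∣cY t = *-cancelˡ-∣ (pos 2) (∣-resp (trans
        (sum-cong (λ k → trans (cong (c k *_) (X≡2Y k t)) (rearrange (c k) (Y k t))))
        (sym (*-sum (pos 2) (λ k → c k * Y k t)))) (4∣ t))
        where
        rearrange : ∀ c y → c * (pos 2 * y) ≡ pos 2 * (c * y)
        rearrange = solve-∀
      2^-double : ∀ k → pos 2 ^ (k ℕ.* 2) ≡ pos 2 ^ k * pos 2 ^ k
      2^-double zero = refl
      2^-double (suc k) = trans (cong (λ x → pos 2 * (pos 2 * x)) (2^-double k)) (rearrange (pos 2) (pos 2 ^ k))
        where
        rearrange : ∀ t x → t * (t * (x * x)) ≡ t * x * (t * x)
        rearrange = solve-∀
      FY≡m² : F Y ≡ m * m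
      FY≡m² = cancel-2^ (r ℕ.* 2) (begin
        pos 2 ^ (r ℕ.* 2) * F Y ≡⟨ form-scale Φ (pos 2) Y ⟨
        F (λ k t → pos 2 * Y k t) ≡⟨ AltForm.congruent Φ X≡2Y ⟨
        F X ≡⟨ trans FX≡ detCols-gram ⟩
        det W * det W ≡⟨ cong₂ _*_ detW detW ⟩
        pos 2 ^ r * m * (pos 2 ^ r * m) ≡⟨ rearrange (pos 2 ^ r) m ⟩
        pos 2 ^ r * pos 2 ^ r * (m * m) ≡⟨ cong (_* (m * m)) (2^-double r) ⟨
        pos 2 ^ (r ℕ.* 2) * (m * m) ∎)
        where
        rearrange : ∀ t x → t * x * (t * x) ≡ t * t * (x * x)
        rearrange = solve-∀
      FY-odd : ¬ (pos 2 ∣ F Y)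
      FY-odd 2∣FY = m-odd (Sum.reduce (euclid prime[2] m m (∣-resp FY≡m² 2∣FY)))

    -- To be instantiated with `s` the parity of `n`. For odd `n` the vector `w 0` has odd norm `n`
    -- and is left out; from index `s` on, all products with walk vectors are even.
    module Shifted (s : ℕ)
      (h-even-s : ∀ (j k : ℕ) → pos 2 ∣ h (s ℕ.+ j) k)
      (nonsingular-s : ∀ (c : Fin (r ℕ.* 2) → ℤ) → (∀ (t : Fin n) → pos 4 ∣ sumℤ (λ k → c k * h (s ℕ.+ toℕ k) (toℕ t))) →
                       ∀ (k : Fin (r ℕ.* 2)) → pos 2 ∣ c k)
      (half-≥ : ∀ (t B : ℕ) → s ℕ.+ t ≡ B ℕ.+ B → ∃ λ b → B ≡ s ℕ.+ b)
      where

      -- The norm conditions are turned into the rows of the hypothesis of `nonsingular-s` for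
      -- `dbl c`: `diagonal` evaluates the norms modulo 4, and `row` matches them with Gram rows.
      isotropic-independent : ∀ c → (∀ b → let v = pow b (comb c (λ a → w (s ℕ.+ toℕ a))) in pos 4 ∣ dot v v) →
        ∀ (a : Fin r) → pos 2 ∣ c a
      isotropic-independent c 4∣ = dbl-∣ c (nonsingular-s (dbl c) (λ t →
        ∣-resp (sym (sum-dbl c (λ k → h (s ℕ.+ k) (toℕ t)))) (row (toℕ t))))
        where
        index : ℕ → Fin r → ℕ
        index b a = s ℕ.+ (b ℕ.+ toℕ a)
        diag-term : ℕ → Fin r → ℤ
        diag-term b a = c a * h 0 (index b a ℕ.+ index b a)
        row-term : ℕ → Fin r → ℤ
        row-term t a = c a * h (s ℕ.+ toℕ a ℕ.* 2) t
        -- By `square-comb` the norm of the `b`-th iterate is the sum of the `c a` times norms of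
        -- walk vectors; these norms are even, so their signs do not matter modulo 4.
        diagonal : ∀ b → pos 4 ∣ sumℤ (diag-term b)
        diagonal b = ∣-cong′ {x = sumℤ norm-term} {sumℤ (diag-term b)} (sum-∣- norm-term (diag-term b) sign-off)
          (∣-cong′ {x = dot (comb c Z) (comb c Z)} {sumℤ norm-term} (square-comb c Z even)
            (∣-resp (dot-cong v≗ v≗) (4∣ b)))
          where
          Z : Family r n
          Z a = w (index b a)
          norm-term : Fin r → ℤ
          norm-term a = c a * dot (Z a) (Z a)
          even : ∀ a a′ → pos 2 ∣ dot (Z a) (Z a′)
          even a a′ = h-even-s (b ℕ.+ toℕ a) (index b a′)
          commute : ∀ b s a → b ℕ.+ (s ℕ.+ a) ≡ s ℕ.+ (b ℕ.+ a)
          commute = solveℕ-∀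
          v≗ : ∀ i → pow b (comb c (λ a → w (s ℕ.+ toℕ a))) i ≡ comb c Z i
          v≗ i = trans (pow-comb b c (λ a → w (s ℕ.+ toℕ a)) i)
            (sum-cong (λ a → cong (λ f → c a * f i) (trans (pow-w b (s ℕ.+ toℕ a)) (cong w (commute b s (toℕ a))))))
          sign-off : ∀ a → pos 4 ∣ norm-term a - diag-term b a
          sign-off a = ∣-resp (distrib (c a) (dot (Z a) (Z a)) (h 0 (index b a ℕ.+ index b a)))
            (∣n⇒∣m*n (c a) (≈±-mod4 (h≈± (index b a) (index b a))
              (∣-≈± (sym-≈± (h≈± (index b a) (index b a))) (even a a))))
            where
            distrib : ∀ c x y → c * (x - y) ≡ c * x - c * y
            distrib = solve-∀
        rearrange : ∀ s a t → s ℕ.+ a ℕ.* 2 ℕ.+ t ≡ s ℕ.+ t ℕ.+ a ℕ.* 2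
        rearrange = solveℕ-∀
        row : ∀ t → pos 4 ∣ sumℤ (row-term t)
        row t with parity (s ℕ.+ t)
        -- The total index `s + 2a + t` is odd for every `a`, so all these Gram entries are zero.
        ... | inj₂ (B , eq) = ∣-sum (λ a → ∣n⇒∣m*n (c a) (∣-resp (sym (vanish a)) ∣0))
          where
          index-odd : ∀ a → s ℕ.+ a ℕ.* 2 ℕ.+ t ≡ suc ((B ℕ.+ a) ℕ.+ (B ℕ.+ a))
          index-odd a = trans (rearrange s a t) (trans (cong (ℕ._+ a ℕ.* 2) eq) (collect B a))
            where
            collect : ∀ B a → suc (B ℕ.+ B) ℕ.+ a ℕ.* 2 ≡ suc ((B ℕ.+ a) ℕ.+ (B ℕ.+ a))
            collect = solveℕ-∀
          vanish : ∀ (a : Fin r) → h (s ℕ.+ toℕ a ℕ.* 2) t ≡ 0ℤ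
          vanish a = ≈±0 (h≈± (s ℕ.+ toℕ a ℕ.* 2) t) (trans (cong (h 0) (index-odd (toℕ a))) (h-odd (B ℕ.+ toℕ a)))
        -- With `s + t = 2(s + b)` the total index is `2(s + b + a)`, the one occurring in the norm
        -- of the `b`-th iterate. `B` must be at least `s` because the combination starts at `w s`.
        ... | inj₁ (B , eq) with half-≥ t B eq
        ...   | b , refl = ∣-cong {x = sumℤ (row-term t)} {sumℤ (diag-term b)}
                  (sum-∣- (row-term t) (diag-term b) sign-off) (diagonal b)
          where
          index-even : ∀ a → s ℕ.+ a ℕ.* 2 ℕ.+ t ≡ (s ℕ.+ (b ℕ.+ a)) ℕ.+ (s ℕ.+ (b ℕ.+ a))
          index-even a = trans (rearrange s a t) (trans (cong (ℕ._+ a ℕ.* 2) eq) (collect s b a))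
            where
            collect : ∀ s b a → (s ℕ.+ b) ℕ.+ (s ℕ.+ b) ℕ.+ a ℕ.* 2 ≡ (s ℕ.+ (b ℕ.+ a)) ℕ.+ (s ℕ.+ (b ℕ.+ a))
            collect = solveℕ-∀
          sign-off : ∀ a → pos 4 ∣ row-term t a - diag-term b a
          sign-off a = ∣-resp (distrib (c a) (h (s ℕ.+ toℕ a ℕ.* 2) t) (h 0 (index b a ℕ.+ index b a)))
            (∣n⇒∣m*n (c a) (≈±-mod4 same (∣-≈± (sym-≈± same) (h-even-s (toℕ a ℕ.* 2) t))))
            where
            same : h (s ℕ.+ toℕ a ℕ.* 2) t ≈± h 0 (index b a ℕ.+ index b a)
            same = subst (λ l → h (s ℕ.+ toℕ a ℕ.* 2) t ≈± h 0 l) (index-even (toℕ a)) (h≈± (s ℕ.+ toℕ a ℕ.* 2) t)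
            distrib : ∀ c x y → c * (x - y) ≡ c * x - c * y
            distrib = solve-∀

      even-vector : ∀ y → (∀ j → pos 2 ∣ dot y (w j)) → (∀ b → pos 4 ∣ dot (pow b y) (pow b y)) → ∀ i → pos 2 ∣ y i
      even-vector y 2∣yW 4∣y² i with pos 2 ∣? y i
      ... | yes 2∣yᵢ = 2∣yᵢ
      ... | no 2∤yᵢ = contradiction 2∣m m-odd
        where
        U : Family (suc r) n
        U = y ∷ λ a → w (s ℕ.+ toℕ a)

        independent : Independent (pos 2) U
        independent c 2∣cU = λ { zero → 2∣c₀ ; (suc a) → 2∣c′ a }
          where
          c₀ = c zero
          v : Fin n → ℤ
          v = comb (c ∘ suc) (U ∘ suc)
          z : Fin n → ℤ
          z t = _∣_.quotient (2∣cU t)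
          -- The dependency makes `v` a multiple of `y` up to the even error `2z`; in the norm the
          -- cross term then carries a factor 4.
          v≗ : ∀ t → v t ≡ - c₀ * y t + pos 2 * z t
          v≗ t = trans (isolate c₀ (y t) (v t))
            (cong (- c₀ * y t +_) (trans (_∣_.equality (2∣cU t)) (*-comm (z t) (pos 2))))
            where
            isolate : ∀ c y v → v ≡ - c * y + (c * y + v)
            isolate = solve-∀
          4∣v² : ∀ b → pos 4 ∣ dot (pow b v) (pow b v)
          4∣v² b = ∣-resp (sym (trans (dot-cong vᵇ vᵇ) (square-linear (- c₀) (pos 2) (pow b y) (pow b z))))
            (∣m∣n⇒∣m+n (∣m∣n⇒∣m+n square-y cross) square-z)
            where
            vᵇ : ∀ i → pow b v i ≡ - c₀ * pow b y i + pos 2 * pow b z i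
            vᵇ i = trans (pow-cong b v≗ i) (pow-linear b (- c₀) (pos 2) y z i)
            square-y : pos 4 ∣ - c₀ * - c₀ * dot (pow b y) (pow b y)
            square-y = ∣n⇒∣m*n (- c₀ * - c₀) (4∣y² b)
            cross : pos 4 ∣ pos 2 * (- c₀ * pos 2 * dot (pow b y) (pow b z))
            cross = divides (- c₀ * dot (pow b y) (pow b z)) (rearrange c₀ (dot (pow b y) (pow b z)))
              where
              rearrange : ∀ c x → pos 2 * (- c * pos 2 * x) ≡ - c * x * pos 4
              rearrange = solve-∀
            square-z : pos 4 ∣ pos 2 * pos 2 * dot (pow b z) (pow b z)
            square-z = divides (dot (pow b z) (pow b z)) (*-comm (pos 4) (dot (pow b z) (pow b z)))
          2∣c′ : ∀ a → pos 2 ∣ c (suc a)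
          2∣c′ = isotropic-independent (c ∘ suc) 4∣v²
          2∣c₀ : pos 2 ∣ c₀
          2∣c₀ = euclid-∤ prime[2] (y i) c₀ 2∤yᵢ (∣-resp (*-comm c₀ (y i))
            (∣m+n∣n⇒∣m {m = c₀ * y i} {n = v i} (2∣cU i) (∣-sum (λ a → ∣m⇒∣m*n (U (suc a) i) (2∣c′ a)))))

        kernel : ∀ j t → pos 2 ∣ comb (U j) W t
        kernel zero t = 2∣yW (toℕ t)
        kernel (suc a) t = h-even-s (toℕ a) (toℕ t)

        2^∣det⇒2∣m : pos 2 ^ suc r ∣ detCols W → pos 2 ∣ m
        2^∣det⇒2∣m (divides q eq) = divides q (cancel-2^ r {m} {q * pos 2} (trans (sym detW)
          (trans (sym detCols-W) (trans eq (rearrange q (pos 2) (pos 2 ^ r))))))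
          where
          rearrange : ∀ q t x → q * (t * x) ≡ x * (q * t)
          rearrange = solve-∀

        2∣m : pos 2 ∣ m
        2∣m = 2^∣det⇒2∣m (independent-kernel prime[2] detCols-form W U independent kernel)

even-vector : ∀ {n} (Σ′ : OrientedGraph n) → let open Walks Σ′ in
  ∀ r m → n ≡ r ℕ.* 2 ⊎ n ≡ suc (r ℕ.* 2) → ¬ (pos 2 ∣ m) → det W ≡ pos 2 ^ r * m →
  ∀ y → (∀ j → pos 2 ∣ dot y (w j)) → (∀ b → pos 4 ∣ dot (pow b y) (pow b y)) → ∀ i → pos 2 ∣ y i
-- For even `n` the whole Gram matrix is even, its corner entry being `n` itself.
even-vector Σ′ r m (inj₁ refl) m-odd detW =
  Shifted.even-vector 0 even (nonsingular detCols-form gram refl (λ k t → even (toℕ k) (toℕ t))) (λ t B eq → B , refl)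
  where
  open Walks Σ′
  open TwoPart r m m-odd detW
  even′ : ∀ l → pos 2 ∣ h 0 l
  even′ zero = divides (pos r) (trans (sum-1 (r ℕ.* 2)) (ℤₚ.pos-* r 2))
  even′ (suc l) = h-even l
  even : ∀ j k → pos 2 ∣ h j k
  even j k = ∣-≈± (h≈± j k) (even′ (j ℕ.+ k))
-- For odd `n` the Gram column of `w 0` is held fixed; the remaining `2r` columns are even.
even-vector Σ′ r m (inj₂ refl) m-odd detW =
  Shifted.even-vector 1 even
    (nonsingular (cons-form detCols-form (gram zero)) (gram ∘ suc)
      (sym (AltForm.congruent detCols-form (cons-η gram))) (λ k t → even (toℕ k) (toℕ t)))
    -- `B = 0` is impossible, as `1 + t` is positive.
    λ { t (suc B) eq → B , refl }
  where
  open Walks Σ′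
  open TwoPart r m m-odd detW
  even : ∀ j k → pos 2 ∣ h (suc j) k
  even j k = ∣-≈± (h≈± (suc j) k) (h-even (j ℕ.+ k))

-- Scaled orthogonal matrices and odd primes

infixl 7 _⊗_
-- Written with `comb`, so that a product is a family of combinations to which `form-comb` applies
-- as it stands.
_⊗_ : ∀ {n} → Mat ℤ n → Mat ℤ n → Mat ℤ n
(A ⊗ B) i = comb (A i) B

col : ∀ {n} → Mat ℤ n → Fin n → Fin n → ℤ
col A j i = A i j

⊗-assoc : ∀ {n} (A B C : Mat ℤ n) → ((A ⊗ B) ⊗ C) ≋ (A ⊗ (B ⊗ C))
⊗-assoc A B C i j = dot-comb (A i) B (col C j)

⊗-congˡ : ∀ {n} {A B : Mat ℤ n} (C : Mat ℤ n) → A ≋ B → (A ⊗ C) ≋ (B ⊗ C)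
⊗-congˡ C A≋B i j = sum-cong (λ k → cong (_* C k j) (A≋B i k))

⊗-congʳ : ∀ {n} (A : Mat ℤ n) {B C : Mat ℤ n} → B ≋ C → (A ⊗ B) ≋ (A ⊗ C)
⊗-congʳ A B≋C i j = sum-cong (λ k → cong (A i k *_) (B≋C k j))

scaled-⊗ : ∀ {n} c (A B : Mat ℤ n) i j → ((λ i j → c * A i j) ⊗ B) i j ≡ c * (A ⊗ B) i j
scaled-⊗ c A B i j = trans (sum-cong (λ k → *-assoc c (A i k) (B k j))) (sym (*-sum c (λ k → A i k * B k j)))

⊗-scaled : ∀ {n} c (A B : Mat ℤ n) i j → (A ⊗ (λ i j → c * B i j)) i j ≡ c * (A ⊗ B) i j
⊗-scaled c A B i j = trans (sum-cong (λ k → rearrange (A i k) c (B k j))) (sym (*-sum c (λ k → A i k * B k j)))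
  where
  rearrange : ∀ a c b → a * (c * b) ≡ c * (a * b)
  rearrange = solve-∀

scalar-⊗ : ∀ {n} c (A : Mat ℤ n) i j → ((λ i j → c * idℤ i j) ⊗ A) i j ≡ c * A i j
scalar-⊗ c A i j = trans (scaled-⊗ c idℤ A i j) (cong (c *_) (sum-idˡ i (col A j)))

⊗-scalar : ∀ {n} c (A : Mat ℤ n) i j → (A ⊗ (λ i j → c * idℤ i j)) i j ≡ c * A i j
⊗-scalar c A i j = trans (⊗-scaled c A idℤ i j) (cong (c *_) (sum-idʳ j (A i)))

*-cancel : ∀ c {x y} → c ≢ 0ℤ → c * x ≡ c * y → x ≡ y
*-cancel c {x} {y} c≢0 = ℤₚ.*-cancelˡ-≡ c x y {{ℤ.≢-nonZero c≢0}}

-- `X = BA - c` satisfies `XB = 0`, and `detCols B` is nonzero because its product with `det A` is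
-- `c ^ n`; Cramer's rule modulo `0ℤ` then makes each entry of `X` zero.
inverse-comm : ∀ {n} (A B : Mat ℤ n) c → c ≢ 0ℤ →
  (∀ i j → (A ⊗ B) i j ≡ c * idℤ i j) → ∀ i j → (B ⊗ A) i j ≡ c * idℤ i j
inverse-comm {n} A B c c≢0 AB≡c i j = ℤₚ.i-j≡0⇒i≡j _ _ (X≡0 i j)
  where
  X : Mat ℤ n
  X i j = (B ⊗ A) i j - c * idℤ i j
  detAB : det A * detCols B ≡ c ^ n
  detAB = begin
    det A * detCols B ≡⟨ form-comb detCols-form A B ⟨
    detCols (A ⊗ B) ≡⟨ AltForm.congruent (detCols-form {n}) AB≡c ⟩
    detCols {n} (λ i j → c * idℤ i j) ≡⟨ form-scale (detCols-form {n}) c idℤ ⟩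
    c ^ n * detCols (idℤ {n}) ≡⟨ cong (c ^ n *_) (trans (det-transpose (idℤ {n})) (det-id {n})) ⟩
    c ^ n * 1ℤ ≡⟨ *-identityʳ _ ⟩
    c ^ n ∎
  detB≢0 : detCols B ≢ 0ℤ
  detB≢0 eq = c≢0 (ℤₚ.i^n≡0⇒i≡0 c n (trans (sym detAB) (trans (cong (det A *_) eq) (*-zeroʳ (det A)))))
  XB≡0 : ∀ i t → comb (X i) B t ≡ 0ℤ
  XB≡0 i t = begin
    comb (X i) B t
      ≡⟨ sum-cong (λ k → expand ((B ⊗ A) i k) (c * idℤ i k) (B k t)) ⟩
    sumℤ (λ k → 1ℤ * ((B ⊗ A) i k * B k t) + -1ℤ * (c * idℤ i k * B k t))
      ≡⟨ sum-linear 1ℤ -1ℤ (λ k → (B ⊗ A) i k * B k t) (λ k → c * idℤ i k * B k t) ⟩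
    1ℤ * ((B ⊗ A) ⊗ B) i t + -1ℤ * ((λ i j → c * idℤ i j) ⊗ B) i t
      ≡⟨ cong₂ (λ a b → 1ℤ * a + -1ℤ * b)
           (trans (⊗-assoc B A B i t) (trans (⊗-congʳ B AB≡c i t) (⊗-scalar c B i t))) (scalar-⊗ c B i t) ⟩
    1ℤ * (c * B i t) + -1ℤ * (c * B i t)
      ≡⟨ cancel (c * B i t) ⟩
    0ℤ ∎
    where
    expand : ∀ a b x → (a - b) * x ≡ 1ℤ * (a * x) + -1ℤ * (b * x)
    expand = solve-∀
    cancel : ∀ x → 1ℤ * x + -1ℤ * x ≡ 0ℤ
    cancel = solve-∀
  X≡0 : ∀ i j → X i j ≡ 0ℤ
  X≡0 i j = [ (λ eq → eq) , (λ eq → contradiction eq detB≢0) ]′ (ℤₚ.i*j≡0⇒i≡0∨j≡0 (X i j)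
    (0∣⇒≡0 (∣-cramer detCols-form B (X i) j (λ t → ∣-resp (sym (XB≡0 i t)) ∣0))))

-- The conditions on a rational matrix Q, cleared of denominators by `N = LQ`, so that the
-- arithmetic takes place over the integers.
record ScaledConjugation {n} (Σ′ Δ : OrientedGraph n) (L : ℤ) (N : Mat ℤ n) : Set where
  field
    orthogonal : ∀ i j → dot (col N i) (col N j) ≡ L * L * idℤ i j
    row-sum    : ∀ i → sumℤ (N i) ≡ L
    conjugate  : ∀ i j → dot (col N i) (matVec (S Σ′) (col N j)) ≡ L * L * S Δ i j

module Conjugation {n} {Σ′ Δ : OrientedGraph n} {L : ℤ} {N : Mat ℤ n} (L≢0 : L ≢ 0ℤ)
  (conjugation : ScaledConjugation Σ′ Δ L N) where
  open ScaledConjugation conjugation public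
  open Walks Σ′

  T : Mat ℤ n
  T = S Δ

  L²≢0 : L * L ≢ 0ℤ
  L²≢0 eq = L≢0 (Sum.reduce (ℤₚ.i*j≡0⇒i≡0∨j≡0 L eq))

  orthogonal′ : ∀ i j → (N ⊗ col N) i j ≡ L * L * idℤ i j
  orthogonal′ = inverse-comm (col N) N (L * L) L²≢0 orthogonal

  -- S(Σ)Q = QS(Δ), recovered from the conjugation by multiplying with NNᵀ = L².
  intertwine : (A ⊗ N) ≋ (N ⊗ T)
  intertwine i j = *-cancel (L * L) L²≢0 (begin
    L * L * (A ⊗ N) i j                        ≡⟨ scalar-⊗ (L * L) (A ⊗ N) i j ⟨
    ((λ i j → L * L * idℤ i j) ⊗ (A ⊗ N)) i j  ≡⟨ ⊗-congˡ (A ⊗ N) orthogonal′ i j ⟨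
    ((N ⊗ col N) ⊗ (A ⊗ N)) i j                ≡⟨ ⊗-assoc N (col N) (A ⊗ N) i j ⟩
    (N ⊗ (col N ⊗ (A ⊗ N))) i j                ≡⟨ ⊗-congʳ N conjugate i j ⟩
    (N ⊗ (λ i j → L * L * T i j)) i j          ≡⟨ ⊗-scaled (L * L) N T i j ⟩
    L * L * (N ⊗ T) i j ∎)

  -- Replacing the factor `L` by row sums turns `L` times the column sum into the sum of the
  -- products of column `j` with all columns, which orthogonality reduces to `L * L`.
  column-sum : ∀ j → sumℤ (col N j) ≡ L
  column-sum j = *-cancel L L≢0 (begin
    L * sumℤ (col N j)
      ≡⟨ *-sum L (col N j) ⟩
    sumℤ (λ k → L * N k j)
      ≡⟨ sum-cong (λ k → trans (cong (_* N k j) (sym (row-sum k)))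
           (trans (sum-* (N k j) (N k)) (sum-cong (λ l → *-comm (N k l) (N k j))))) ⟩
    sumℤ (λ k → sumℤ (λ l → N k j * N k l))
      ≡⟨ sum-swap (λ k l → N k j * N k l) ⟩
    sumℤ (λ l → dot (col N j) (col N l))
      ≡⟨ sum-cong (orthogonal j) ⟩
    sumℤ (λ l → L * L * idℤ j l)
      ≡⟨ trans (sum-cong (λ l → *-comm (L * L) (idℤ j l))) (sum-idˡ j (λ _ → L * L)) ⟩
    L * L ∎)

  image-skew : ∀ a i → matVec A (matVec N a) i ≡ matVec N (matVec T a) i
  image-skew a i = begin
    matVec A (matVec N a) i ≡⟨ dot-comb (A i) N a ⟨
    dot ((A ⊗ N) i) a       ≡⟨ dot-congˡ a (intertwine i) ⟩
    dot ((N ⊗ T) i) a       ≡⟨ dot-comb (N i) T a ⟩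
    matVec N (matVec T a) i ∎

  image-pow : ∀ b a i → pow b (matVec N a) i ≡ matVec N (Walks.pow Δ b a) i
  image-pow zero a i = refl
  image-pow (suc b) a i = trans (matVec-cong A (image-pow b a) i) (image-skew (Walks.pow Δ b a) i)

  image-dot : ∀ a a′ → dot (matVec N a) (matVec N a′) ≡ L * L * dot a a′
  image-dot a a′ = begin
    dot (matVec N a) (matVec N a′)
      ≡⟨ dot-adjoint N a (matVec N a′) ⟩
    dot a (matVec (col N) (matVec N a′))
      ≡⟨ sum-cong (λ i → cong (a i *_) (trans (sym (dot-comb (col N i) N a′)) (dot-congˡ a′ (orthogonal i)))) ⟩
    dot a (λ i → dot (λ j → L * L * idℤ i j) a′)
      ≡⟨ sum-cong (λ i → cong (a i *_) (pull i)) ⟩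
    sumℤ (λ i → a i * (L * L * a′ i))
      ≡⟨ sum-cong (λ i → rearrange (a i) (L * L) (a′ i)) ⟩
    sumℤ (λ i → L * L * (a i * a′ i))
      ≡⟨ *-sum (L * L) (λ i → a i * a′ i) ⟨
    L * L * dot a a′ ∎
    where
    rearrange : ∀ a c b → a * (c * b) ≡ c * (a * b)
    rearrange = solve-∀
    pull : ∀ i → dot (λ j → L * L * idℤ i j) a′ ≡ L * L * a′ i
    pull i = trans (sum-cong (λ j → *-assoc (L * L) (idℤ i j) (a′ j)))
      (trans (sym (*-sum (L * L) (λ j → idℤ i j * a′ j))) (cong (L * L *_) (sum-idˡ i a′)))

  -- Skew-symmetry moves one factor `A` from the walk vector onto `matVec N a`, where `intertwine`
  -- turns it into `T` acting on `a`; hence the induction needs arbitrary `a`. At `t = 0` the column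
  -- sums supply `L`.
  image-walk : ∀ t a → L ∣ dot (matVec N a) (w t)
  image-walk zero a = ∣-resp (sym (begin
    dot (matVec N a) (λ _ → 1ℤ)
      ≡⟨ dot-adjoint N a (λ _ → 1ℤ) ⟩
    dot a (λ j → sumℤ (λ i → N i j * 1ℤ))
      ≡⟨ sum-cong (λ j → cong (a j *_) (trans (sum-cong (λ i → *-identityʳ (N i j))) (column-sum j))) ⟩
    sumℤ (λ j → a j * L) ∎)) (∣-sum (λ j → ∣n⇒∣m*n (a j) ∣-refl))
  image-walk (suc t) a = ∣-resp eq (∣m⇒∣-m (image-walk t (matVec T a)))
    where
    eq : - dot (matVec N (matVec T a)) (w t) ≡ dot (matVec N a) (w (suc t))
    eq = begin
      - dot (matVec N (matVec T a)) (w t) ≡⟨ cong -_ (dot-congˡ (w t) (λ i → sym (image-skew a i))) ⟩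
      - dot (matVec A (matVec N a)) (w t) ≡⟨ cong -_ (dot-skew (matVec N a) (w t)) ⟩
      - - dot (matVec N a) (w (suc t))    ≡⟨ ℤₚ.neg-involutive _ ⟩
      dot (matVec N a) (w (suc t)) ∎

  column-image : ∀ j i → matVec N (col idℤ j) i ≡ col N j i
  column-image j i = sum-idʳ j (N i)

  column-walk : ∀ j t → L ∣ dot (col N j) (w t)
  column-walk j t = ∣-resp (dot-congˡ (w t) (column-image j)) (image-walk t (col idℤ j))

  -- Powers of `A` pass through `N` as powers of `T`, and `N` multiplies inner products by `L * L`.
  column-pow : ∀ j b → L * L ∣ dot (pow b (col N j)) (pow b (col N j))
  column-pow j b = ∣-resp (sym (trans (dot-cong column≗ column≗) (image-dot a a))) (∣m⇒∣m*n (dot a a) ∣-refl)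
    where
    a : Fin n → ℤ
    a = Walks.pow Δ b (col idℤ j)
    column≗ : ∀ i → pow b (col N j) i ≡ matVec N a i
    column≗ i = trans (pow-cong b (λ i → sym (column-image j i)) i) (image-pow b (col idℤ j) i)

Primitive : ∀ {n} → ℕ → Mat ℤ n → Set
Primitive p N = ∃₂ λ i j → ¬ (pos p ∣ N i j)

∣²∣ : ∀ {d x y} → d ∣ x → d ∣ y → d * d ∣ x * y
∣²∣ {d} (divides a refl) (divides b refl) = divides (a * b) (rearrange a b d)
  where
  rearrange : ∀ a b d → a * d * (b * d) ≡ a * b * (d * d)
  rearrange = solve-∀

-- Isotropic vectors modulo an odd prime

module OddPrime {n} (Σ′ : OrientedGraph n) {p} (p-prime : Prime p) (p≢2 : p ≢ 2)
  (r : ℕ) (m : ℤ) (p²∤m : ¬ (pos p ^ 2 ∣ m)) (detW : det (walkMatrix Σ′) ≡ pos 2 ^ r * m) where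
  open Walks Σ′

  p∤2^ : ∀ k → ¬ (pos p ∣ pos 2 ^ k)
  p∤2^ zero p∣1 = prime-∤1 p-prime p∣1
  p∤2^ (suc k) p∣ with euclid p-prime (pos 2) (pos 2 ^ k) p∣
  ... | inj₂ p∣2ᵏ = p∤2^ k p∣2ᵏ
  ... | inj₁ p∣2 with prime⇒irreducible prime[2] (∣⇒∣ᵤ p∣2)
  ...   | inj₁ refl = ¬prime[1] p-prime
  ...   | inj₂ p≡2 = p≢2 p≡2

  p²∤detW : ¬ (pos p ^ 2 ∣ detCols W)
  p²∤detW p²∣ = p²∤m (power-cancel p-prime 2 (pos 2 ^ r) m (p∤2^ r) (∣-resp (trans detCols-W detW) p²∣))

  -- A column of `N` with an entry prime to `p` lies in the kernel of Wᵀ modulo `L`; if p² divided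
  -- `L`, Cramer's rule at that entry would give p² ∣ det W.
  p²∤level : ∀ {Δ L N} → L ≢ 0ℤ → ScaledConjugation Σ′ Δ L N → Primitive p N → ¬ (pos p ^ 2 ∣ L)
  p²∤level {N = N} L≢0 conjugation (i , j , p∤N) p²∣L =
    p²∤detW (power-cancel p-prime 2 (N i j) (detCols W) p∤N (∣-cramer detCols-form W (col N j) i p²∣))
    where
    p²∣ : ∀ t → pos p ^ 2 ∣ comb (col N j) W t
    p²∣ t = ∣-trans p²∣L (Conjugation.column-walk L≢0 conjugation j (toℕ t))

  record Isotropic (x : Fin n → ℤ) : Set where
    field
      kernel : ∀ t → pos p ∣ dot x (w t)
      square : pos p ^ 2 ∣ dot x x
  open Isotropic

  Unit : (Fin n → ℤ) → Set
  Unit x = ∃ λ i → ¬ (pos p ∣ x i)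

  -- If p² did not divide x·y, squaring αx + βy ≡ 0 would give p² ∣ 2αβ(x·y), hence p ∣ α or p ∣ β,
  -- and then both, as neither vector vanishes modulo `p`. So `x` and `y` would be independent
  -- kernel vectors, against p² ∤ det W.
  isotropic-unit-dot : ∀ x y → Isotropic x → Isotropic y → Unit x → Unit y → pos p ^ 2 ∣ dot x y
  isotropic-unit-dot x y x-iso y-iso (i , p∤xᵢ) (j , p∤yⱼ) with pos p ^ 2 ∣? dot x y
  ... | yes p²∣xy = p²∣xy
  ... | no p²∤xy = contradiction (independent-kernel p-prime detCols-form W U independent ker) p²∤detW
    where
    U : Family 2 n
    U zero = x
    U (suc zero) = y
    ker : ∀ k t → pos p ∣ comb (U k) W t
    ker zero t = kernel x-iso (toℕ t)
    ker (suc zero) t = kernel y-iso (toℕ t)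
    module _ (c : Fin 2 → ℤ) (p∣cU : ∀ t → pos p ∣ comb c U t) where
      α = c zero
      β = c (suc zero)
      z : Fin n → ℤ
      z t = α * x t + β * y t
      p∣z : ∀ t → pos p ∣ z t
      p∣z t = ∣-resp (cong (α * x t +_) (+-identityʳ (β * y t))) (p∣cU t)
      p²∣z² : pos p ^ 2 ∣ dot z z
      p²∣z² = ∣-sum (λ t → ∣-resp′ (∣²∣ (p∣z t) (p∣z t)))
        where
        ∣-resp′ : ∀ {s} → pos p * pos p ∣ s → pos p ^ 2 ∣ s
        ∣-resp′ {s} = subst (_∣ s) (cong (pos p *_) (sym (*-identityʳ (pos p))))
      p²∣cross : pos p ^ 2 ∣ pos 2 * (α * (β * dot x y))
      p²∣cross = ∣-resp (isolate α β (dot x x) (dot x y) (dot y y))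
        (∣m∣n⇒∣m-n (∣m∣n⇒∣m-n (∣-resp (square-linear α β x y) p²∣z²) (∣n⇒∣m*n (α * α) (square x-iso)))
                   (∣n⇒∣m*n (β * β) (square y-iso)))
        where
        isolate : ∀ α β a b c → α * α * a + pos 2 * (α * β * b) + β * β * c - α * α * a - β * β * c ≡
                                pos 2 * (α * (β * b))
        isolate = solve-∀
      p∣α⇒p∣β : pos p ∣ α → pos p ∣ β
      p∣α⇒p∣β p∣α = euclid-∤ p-prime (y j) β p∤yⱼ (∣-resp (*-comm β (y j))
        (∣m+n∣m⇒∣n {m = α * x j} {n = β * y j} (p∣z j) (∣m⇒∣m*n (x j) p∣α)))
      p∣β⇒p∣α : pos p ∣ β → pos p ∣ α
      p∣β⇒p∣α p∣β = euclid-∤ p-prime (x i) α p∤xᵢ (∣-resp (*-comm α (x i))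
        (∣m+n∣n⇒∣m {m = α * x i} {n = β * y i} (p∣z i) (∣m⇒∣m*n (y i) p∣β)))
      both : pos p ∣ α × pos p ∣ β
      both with pos p ∣? α | pos p ∣? β
      ... | yes p∣α | _ = p∣α , p∣α⇒p∣β p∣α
      ... | no _ | yes p∣β = p∣β⇒p∣α p∣β , p∣β
      ... | no p∤α | no p∤β = contradiction
        (power-cancel p-prime 2 β (dot x y) p∤β (power-cancel p-prime 2 α (β * dot x y) p∤α
          (power-cancel p-prime 2 (pos 2) (α * (β * dot x y)) (p∤2^ 1) p²∣cross))) p²∤xy
    independent : Independent (pos p) U
    independent c p∣cU zero = proj₁ (both c p∣cU)
    independent c p∣cU (suc zero) = proj₂ (both c p∣cU)

  infixl 6 _⊕_
  _⊕_ : (Fin n → ℤ) → (Fin n → ℤ) → Fin n → ℤ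
  (x ⊕ y) i = 1ℤ * x i + 1ℤ * y i

  isotropic-⊕ : ∀ x y → Isotropic x → Isotropic y → pos p ^ 2 ∣ dot x y → Isotropic (x ⊕ y)
  isotropic-⊕ x y x-iso y-iso p²∣xy = record
    { kernel = λ t → ∣-resp (sym (dot-linear 1ℤ 1ℤ x y (w t)))
        (∣m∣n⇒∣m+n (∣n⇒∣m*n 1ℤ (kernel x-iso t)) (∣n⇒∣m*n 1ℤ (kernel y-iso t)))
    ; square = ∣-resp (sym (square-linear 1ℤ 1ℤ x y))
        (∣m∣n⇒∣m+n (∣m∣n⇒∣m+n (∣n⇒∣m*n 1ℤ (square x-iso)) (∣n⇒∣m*n (pos 2) (∣n⇒∣m*n 1ℤ p²∣xy)))
                   (∣n⇒∣m*n 1ℤ (square y-iso)))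
    }

  unit-⊕ : ∀ x x₀ → (∀ i → pos p ∣ x i) → Unit x₀ → Unit (x ⊕ x₀)
  unit-⊕ x x₀ p∣x (i , p∤x₀) = i , λ p∣ → p∤x₀ (∣-resp (*-identityˡ (x₀ i))
    (∣m+n∣m⇒∣n {m = 1ℤ * x i} {n = 1ℤ * x₀ i} p∣ (∣n⇒∣m*n 1ℤ (p∣x i))))

  dot-⊕-cancel : ∀ x x₀ y → pos p ^ 2 ∣ dot (x ⊕ x₀) y → pos p ^ 2 ∣ dot x₀ y → pos p ^ 2 ∣ dot x y
  dot-⊕-cancel x x₀ y p²∣ p²∣x₀ = ∣-resp (*-identityˡ (dot x y))
    (∣m+n∣n⇒∣m {m = 1ℤ * dot x y} {n = 1ℤ * dot x₀ y} (∣-resp (dot-linear 1ℤ 1ℤ x x₀ y) p²∣) (∣n⇒∣m*n 1ℤ p²∣x₀))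

  module _ x₀ (x₀-iso : Isotropic x₀) (x₀-unit : Unit x₀) where

    -- The argument by dependencies is silent on an `x` divisible by `p`. Adding `x₀`, nonzero
    -- modulo `p`, makes it applicable, and the product with `x₀` is subtracted afterwards.
    isotropic-dot-unit : ∀ x y → Isotropic x → pos p ^ 2 ∣ dot x x₀ → Isotropic y → Unit y → pos p ^ 2 ∣ dot x y
    isotropic-dot-unit x y x-iso p²∣xx₀ y-iso y-unit with all? (λ i → pos p ∣? x i)
    ... | no ¬p∣x = isotropic-unit-dot x y x-iso y-iso (unit-entry x ¬p∣x) y-unit
    ... | yes p∣x = dot-⊕-cancel x x₀ y
      (isotropic-unit-dot (x ⊕ x₀) y (isotropic-⊕ x x₀ x-iso x₀-iso p²∣xx₀) y-iso (unit-⊕ x x₀ p∣x x₀-unit) y-unit)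
      (isotropic-unit-dot x₀ y x₀-iso y-iso x₀-unit y-unit)

    -- The same correction in the second argument, by `y₀`.
    isotropic-dot : ∀ y₀ → Isotropic y₀ → Unit y₀ → ∀ x y → Isotropic x → pos p ^ 2 ∣ dot x x₀ →
      Isotropic y → pos p ^ 2 ∣ dot y y₀ → pos p ^ 2 ∣ dot x y
    isotropic-dot y₀ y₀-iso y₀-unit x y x-iso p²∣xx₀ y-iso p²∣yy₀ with all? (λ i → pos p ∣? y i)
    ... | no ¬p∣y = isotropic-dot-unit x y x-iso p²∣xx₀ y-iso (unit-entry y ¬p∣y)
    ... | yes p∣y = ∣-resp (dot-comm y x) (dot-⊕-cancel y y₀ x
      (∣-resp (dot-comm x (y ⊕ y₀)) (isotropic-dot-unit x (y ⊕ y₀) x-iso p²∣xx₀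
        (isotropic-⊕ y y₀ y-iso y₀-iso p²∣yy₀) (unit-⊕ y y₀ p∣y y₀-unit)))
      (∣-resp (dot-comm x y₀) (isotropic-dot-unit x y₀ x-iso p²∣xx₀ y₀-iso y₀-unit)))

  columns-dot : ∀ {Δ Γ L N N₁} → L ≢ 0ℤ → pos p ∣ L →
    ScaledConjugation Σ′ Δ L N → ScaledConjugation Σ′ Γ L N₁ → Primitive p N → Primitive p N₁ →
    ∀ i j → pos p ^ 2 ∣ dot (col N i) (col N₁ j)
  columns-dot {L = L} {N} {N₁} L≢0 p∣L conjugation conjugation₁ (k , i₀ , p∤N) (k₁ , j₀ , p∤N₁) i j =
    -- The correcting vectors are the columns through the entries prime to `p`; modulo p² they are
    -- orthogonal to all columns of their own matrix because p ∣ L.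
    isotropic-dot (col N i₀) (isotropic conjugation i₀) (k , p∤N)
      (col N₁ j₀) (isotropic conjugation₁ j₀) (k₁ , p∤N₁)
      (col N i) (col N₁ j) (isotropic conjugation i) (orthogonal-columns conjugation i i₀)
      (isotropic conjugation₁ j) (orthogonal-columns conjugation₁ j j₀)
    where
    orthogonal-columns : ∀ {Δ N} → ScaledConjugation Σ′ Δ L N → ∀ i j → pos p ^ 2 ∣ dot (col N i) (col N j)
    orthogonal-columns con i j = ∣-resp (sym (ScaledConjugation.orthogonal con i j))
      (∣m⇒∣m*n (idℤ i j) (subst (_∣ L * L) (cong (pos p *_) (sym (*-identityʳ (pos p)))) (∣²∣ p∣L p∣L)))
    isotropic : ∀ {Δ N} → ScaledConjugation Σ′ Δ L N → ∀ i → Isotropic (col N i)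
    isotropic con i = record
      { kernel = λ t → ∣-trans p∣L (Conjugation.column-walk L≢0 con i t)
      ; square = orthogonal-columns con i i
      }

-- As p² does not divide the product, `p` is prime to the product of the remaining factors, so the
-- squares of the two can be multiplied.
square-∣ : ∀ {x} ps → All.All Prime ps →
  (∀ p → Prime p → pos p ∣ pos (product ps) → ¬ (pos p ^ 2 ∣ pos (product ps)) × pos p ^ 2 ∣ x) →
  pos (product ps) * pos (product ps) ∣ x
square-∣ {x} List.[] All.[] hyp = divides x (sym (*-identityʳ x))
square-∣ {x} (p List.∷ ps) (p-prime All.∷ ps-prime) hyp
  with square-∣ {x} ps ps-prime (λ q q-prime q∣Π →
         (λ q²∣Π → proj₁ (hyp q q-prime (∣-trans q∣Π Π∣pΠ)) (∣-trans q²∣Π Π∣pΠ)) ,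
         proj₂ (hyp q q-prime (∣-trans q∣Π Π∣pΠ)))
  where
  Π∣pΠ : pos (product ps) ∣ pos (product (p List.∷ ps))
  Π∣pΠ = ∣-resp (sym (ℤₚ.pos-* p (product ps))) (∣n⇒∣m*n (pos p) ∣-refl)
... | divides y refl = ∣-resp (*-comm Π² y) (subst (_∣ Π² * y) square-product (*-monoʳ-∣ Π² p²∣y))
  where
  Π Π² : ℤ
  Π = pos (product ps)
  Π² = Π * Π
  p∣pΠ : pos p ∣ pos (product (p List.∷ ps))
  p∣pΠ = ∣-resp (sym (ℤₚ.pos-* p (product ps))) (∣m⇒∣m*n Π ∣-refl)
  p∤Π : ¬ (pos p ∣ Π)
  p∤Π p∣Π = proj₁ (hyp p p-prime p∣pΠ)
    (∣-resp (sym (ℤₚ.pos-* p (product ps)))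
      (subst (_∣ pos p * Π) (cong (pos p *_) (sym (*-identityʳ (pos p)))) (*-monoʳ-∣ (pos p) p∣Π)))
  p∤Π² : ¬ (pos p ∣ Π²)
  p∤Π² p∣Π² = p∤Π (Sum.reduce (euclid p-prime Π Π p∣Π²))
  p²∣y : pos p ^ 2 ∣ y
  p²∣y = power-cancel p-prime 2 Π² y p∤Π² (∣-resp (*-comm y Π²) (proj₂ (hyp p p-prime p∣pΠ)))
  square-product : Π² * pos p ^ 2 ≡ pos (product (p List.∷ ps)) * pos (product (p List.∷ ps))
  square-product = trans (rearrange Π (pos p)) (cong₂ _*_ (sym (ℤₚ.pos-* p (product ps))) (sym (ℤₚ.pos-* p (product ps))))
    where
    rearrange : ∀ Π p → Π * Π * (p * (p * 1ℤ)) ≡ p * Π * (p * Π)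
    rearrange = solve-∀

-- Permutation matrices

sum-pos-zero : ∀ {n} (f : Fin n → ℤ) → (∀ i → ∃ λ k → f i ≡ pos k) → sumℤ f ≡ 0ℤ → ∀ i → f i ≡ 0ℤ
sum-pos-zero {suc n} f f≡pos Σ≡0 = λ { zero → f₀≡0 ; (suc i) → sum-pos-zero (f ∘ suc) (f≡pos ∘ suc) rest≡0 i }
  where
  sum-pos : ∀ {n} (g : Fin n → ℤ) → (∀ i → ∃ λ k → g i ≡ pos k) → ∃ λ k → sumℤ g ≡ pos k
  sum-pos {zero} g _ = 0 , refl
  sum-pos {suc n} g g≡pos with g≡pos zero | sum-pos (g ∘ suc) (g≡pos ∘ suc)
  ... | k , eq | l , eq′ = k ℕ.+ l , cong₂ _+_ eq eq′
  f₀≡0 : f zero ≡ 0ℤ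
  f₀≡0 with f≡pos zero | sum-pos (f ∘ suc) (f≡pos ∘ suc)
  ... | k , eq | l , eq′ = trans eq (cong pos (ℕₚ.m+n≡0⇒m≡0 k (ℤₚ.+-injective (trans (sym (cong₂ _+_ eq eq′)) Σ≡0))))
  rest≡0 : sumℤ (f ∘ suc) ≡ 0ℤ
  rest≡0 = trans (sym (+-identityˡ _)) (trans (cong (_+ sumℤ (f ∘ suc)) (sym f₀≡0)) Σ≡0)

x²-x≥0 : ∀ x → ∃ λ k → x * x - x ≡ pos k
x²-x≥0 (pos zero) = 0 , refl
x²-x≥0 (pos (suc k)) = suc k ℕ.* k , trans (rearrange (pos k)) (sym (ℤₚ.pos-* (suc k) k))
  where
  rearrange : ∀ x → (1ℤ + x) * (1ℤ + x) - (1ℤ + x) ≡ (1ℤ + x) * x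
  rearrange = solve-∀
x²-x≥0 -[1+ k ] = _ , refl

x²≡x⇒0∨1 : ∀ x → x * x - x ≡ 0ℤ → x ≡ 0ℤ ⊎ x ≡ 1ℤ
x²≡x⇒0∨1 x eq = Sum.map₂ (ℤₚ.i-j≡0⇒i≡j x 1ℤ) (ℤₚ.i*j≡0⇒i≡0∨j≡0 x (trans (factor x) eq))
  where
  factor : ∀ x → x * (x - 1ℤ) ≡ x * x - x
  factor = solve-∀

-- The nonnegative terms x² - x sum to 0, so every entry is 0 or 1.
standard-vector : ∀ {n} (x : Fin n → ℤ) → dot x x ≡ 1ℤ → sumℤ x ≡ 1ℤ → ∃ λ i → ∀ k → x k ≡ idℤ i k
standard-vector {n} x norm total = i , entry
  where
  0∨1 : ∀ k → x k ≡ 0ℤ ⊎ x k ≡ 1ℤ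
  0∨1 k = x²≡x⇒0∨1 (x k) (sum-pos-zero (λ k → x k * x k - x k) (λ k → x²-x≥0 (x k)) vanish k)
    where
    expand : ∀ x → x * x - x ≡ 1ℤ * (x * x) + -1ℤ * x
    expand = solve-∀
    vanish : sumℤ (λ k → x k * x k - x k) ≡ 0ℤ
    vanish = begin
      sumℤ (λ k → x k * x k - x k)              ≡⟨ sum-cong (λ k → expand (x k)) ⟩
      sumℤ (λ k → 1ℤ * (x k * x k) + -1ℤ * x k) ≡⟨ sum-linear 1ℤ -1ℤ (λ k → x k * x k) x ⟩
      1ℤ * dot x x + -1ℤ * sumℤ x               ≡⟨ cong₂ (λ a b → 1ℤ * a + -1ℤ * b) norm total ⟩
      0ℤ ∎
  nonzero : ∃ λ i → x i ≢ 0ℤ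
  nonzero = ¬∀⟶∃¬ n (λ k → x k ≡ 0ℤ) (λ k → x k ℤ.≟ 0ℤ)
    (λ x≗0 → contradiction (trans (sym total) (sum-zero x≗0)) λ ())
  i : Fin n
  i = proj₁ nonzero
  xᵢ≡1 : x i ≡ 1ℤ
  xᵢ≡1 = [ (λ x≡0 → contradiction x≡0 (proj₂ nonzero)) , (λ x≡1 → x≡1) ]′ (0∨1 i)
  entry : ∀ k → x k ≡ idℤ i k
  entry k with 0∨1 k
  ... | inj₂ x≡1 with i Fin.≟ k
  ...   | yes refl = xᵢ≡1
  ...   | no i≢k = contradiction (trans (sym x≡1) (others k i≢k)) λ ()
    where
    others : ∀ k → i ≢ k → x k ≡ 0ℤ
    -- The remaining entries are nonnegative with sum 1 - 1 = 0.
    others = rest x i xᵢ≡1 total (λ k → [ (λ e → 0 , e) , (λ e → 1 , e) ]′ (0∨1 k))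
      where
      rest : ∀ {n} (x : Fin n → ℤ) i → x i ≡ 1ℤ → sumℤ x ≡ 1ℤ → (∀ k → ∃ λ l → x k ≡ pos l) →
        ∀ k → i ≢ k → x k ≡ 0ℤ
      rest {suc n} x i xᵢ≡1 total nonneg k i≢k = trans (cong x (sym (punchIn-punchOut i≢k)))
        (sum-pos-zero (x ∘ punchIn i) (nonneg ∘ punchIn i)
          (trans (difference (sumℤ (x ∘ punchIn i)) (x i)) (cong₂ _-_ (trans (sym (sum-punchIn i x)) total) xᵢ≡1))
          (punchOut i≢k))
        where
        difference : ∀ s a → s ≡ s + a - a
        difference = solve-∀
  entry k | inj₁ x≡0 with i Fin.≟ k
  ... | yes refl = contradiction (trans (sym xᵢ≡1) x≡0) λ ()
  ... | no _ = x≡0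

-- Columns and rows are both standard vectors, the rows by `inverse-comm`. The positions of their
-- ones define inverse maps, since each 1 belongs to one row and one column.
standard-matrix : ∀ {n} (P : Mat ℤ n) → (∀ i j → dot (col P i) (col P j) ≡ idℤ i j) →
  (∀ i → sumℤ (P i) ≡ 1ℤ) → (∀ j → sumℤ (col P j) ≡ 1ℤ) →
  ∃ λ (σ : Permutation′ n) → ∀ j k → P k j ≡ idℤ (σ ⟨$⟩ʳ j) k
standard-matrix {n} P orthogonal row-sum column-sum = permutation σ τ σ∘τ τ∘σ , λ j k → proj₂ (column j) k
  where
  orthogonal′ : ∀ i j → dot (P i) (P j) ≡ idℤ i j
  orthogonal′ i j = trans (inverse-comm (col P) P 1ℤ (λ ())
    (λ i j → trans (orthogonal i j) (sym (*-identityˡ (idℤ i j)))) i j) (*-identityˡ (idℤ i j))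
  column : ∀ j → ∃ λ i → ∀ k → P k j ≡ idℤ i k
  column j = standard-vector (col P j) (trans (orthogonal j j) (id-diag j)) (column-sum j)
  row : ∀ i → ∃ λ j → ∀ k → P i k ≡ idℤ j k
  row i = standard-vector (P i) (trans (orthogonal′ i i) (id-diag i)) (row-sum i)
  σ τ : Fin n → Fin n
  σ j = proj₁ (column j)
  τ i = proj₁ (row i)
  id≡1⇒≡ : ∀ {i j : Fin n} → idℤ i j ≡ 1ℤ → i ≡ j
  id≡1⇒≡ {i} {j} eq with i Fin.≟ j
  ... | yes i≡j = i≡j
  σ∘τ : ∀ i → σ (τ i) ≡ i
  σ∘τ i = id≡1⇒≡ (trans (sym (proj₂ (column (τ i)) i)) (trans (proj₂ (row i) (τ i)) (id-diag (τ i))))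
  τ∘σ : ∀ j → τ (σ j) ≡ j
  τ∘σ j = id≡1⇒≡ (trans (sym (proj₂ (row (σ j)) j)) (trans (proj₂ (column j) (σ j)) (id-diag (σ j))))

-- Integrality of QᵀQ₁ gives the isomorphism

module _ {n} {Σ′ Δ Γ : OrientedGraph n} {L : ℤ} {N N₁ : Mat ℤ n} (L≢0 : L ≢ 0ℤ)
  (con : ScaledConjugation Σ′ Δ L N) (con₁ : ScaledConjugation Σ′ Γ L N₁)
  (L²∣ : ∀ i j → L * L ∣ dot (col N i) (col N₁ j)) where

  private
    module C = Conjugation L≢0 con
    module C₁ = Conjugation L≢0 con₁

    -- The matrix QᵀQ₁ = NᵀN₁ / L².
    P : Mat ℤ n
    P i j = _∣_.quotient (L²∣ i j)

    L²P : ∀ i j → L * L * P i j ≡ dot (col N i) (col N₁ j)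
    L²P i j = trans (*-comm (L * L) (P i j)) (sym (_∣_.equality (L²∣ i j)))

    L²-cancel : ∀ {x y} → L * L * x ≡ L * L * y → x ≡ y
    L²-cancel = *-cancel (L * L) C.L²≢0

    -- Q(QᵀQ₁) = Q₁, as NNᵀ = L². Through it `P` inherits orthogonality and conjugation from `N₁`,
    -- with `N` cancelled by `image-dot`.
    NP≡N₁ : ∀ j k → matVec N (col P j) k ≡ col N₁ j k
    NP≡N₁ j k = L²-cancel (begin
      L * L * (N ⊗ P) k j                          ≡⟨ ⊗-scaled (L * L) N P k j ⟨
      (N ⊗ (λ i j → L * L * P i j)) k j            ≡⟨ ⊗-congʳ N L²P k j ⟩
      (N ⊗ (col N ⊗ N₁)) k j                       ≡⟨ ⊗-assoc N (col N) N₁ k j ⟨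
      ((N ⊗ col N) ⊗ N₁) k j                       ≡⟨ ⊗-congˡ N₁ C.orthogonal′ k j ⟩
      ((λ i j → L * L * idℤ i j) ⊗ N₁) k j         ≡⟨ scalar-⊗ (L * L) N₁ k j ⟩
      L * L * N₁ k j ∎)

    P-orthogonal : ∀ i j → dot (col P i) (col P j) ≡ idℤ i j
    P-orthogonal i j = L²-cancel (begin
      L * L * dot (col P i) (col P j)                   ≡⟨ C.image-dot (col P i) (col P j) ⟨
      dot (matVec N (col P i)) (matVec N (col P j))     ≡⟨ dot-cong (NP≡N₁ i) (NP≡N₁ j) ⟩
      dot (col N₁ i) (col N₁ j)                         ≡⟨ C₁.orthogonal i j ⟩
      L * L * idℤ i j ∎)

    P-conjugate : ∀ i j → S Γ i j ≡ dot (col P i) (matVec (S Δ) (col P j))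
    P-conjugate i j = L²-cancel (begin
      L * L * S Γ i j
        ≡⟨ C₁.conjugate i j ⟨
      dot (col N₁ i) (matVec (S Σ′) (col N₁ j))
        ≡⟨ dot-cong (NP≡N₁ i) (matVec-cong (S Σ′) (NP≡N₁ j)) ⟨
      dot (matVec N (col P i)) (matVec (S Σ′) (matVec N (col P j)))
        ≡⟨ dot-congʳ (matVec N (col P i)) (C.image-skew (col P j)) ⟩
      dot (matVec N (col P i)) (matVec N (matVec (S Δ) (col P j)))
        ≡⟨ C.image-dot (col P i) (matVec (S Δ) (col P j)) ⟩
      L * L * dot (col P i) (matVec (S Δ) (col P j)) ∎)

    P-row-sum : ∀ i → sumℤ (P i) ≡ 1ℤ
    P-row-sum i = L²-cancel (begin
      L * L * sumℤ (P i)                              ≡⟨ *-sum (L * L) (P i) ⟩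
      sumℤ (λ j → L * L * P i j)                      ≡⟨ sum-cong (L²P i) ⟩
      sumℤ (λ j → sumℤ (λ k → N k i * N₁ k j))        ≡⟨ sum-swap (λ j k → N k i * N₁ k j) ⟩
      sumℤ (λ k → sumℤ (λ j → N k i * N₁ k j))
        ≡⟨ sum-cong (λ k → trans (sym (*-sum (N k i) (N₁ k))) (cong (N k i *_) (C₁.row-sum k))) ⟩
      sumℤ (λ k → N k i * L)                          ≡⟨ sum-* L (col N i) ⟨
      sumℤ (col N i) * L                              ≡⟨ cong (_* L) (C.column-sum i) ⟩
      L * L                                           ≡⟨ *-identityʳ (L * L) ⟨
      L * L * 1ℤ ∎)

    P-column-sum : ∀ j → sumℤ (col P j) ≡ 1ℤ
    P-column-sum j = L²-cancel (begin
      L * L * sumℤ (col P j)                          ≡⟨ *-sum (L * L) (col P j) ⟩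
      sumℤ (λ i → L * L * P i j)                      ≡⟨ sum-cong (λ i → L²P i j) ⟩
      sumℤ (λ i → sumℤ (λ k → N k i * N₁ k j))        ≡⟨ sum-swap (λ i k → N k i * N₁ k j) ⟩
      sumℤ (λ k → sumℤ (λ i → N k i * N₁ k j))
        ≡⟨ sum-cong (λ k → trans (sym (sum-* (N₁ k j) (N k))) (cong (_* N₁ k j) (C.row-sum k))) ⟩
      sumℤ (λ k → L * N₁ k j)                         ≡⟨ *-sum L (col N₁ j) ⟨
      L * sumℤ (col N₁ j)                             ≡⟨ cong (L *_) (C₁.column-sum j) ⟩
      L * L                                           ≡⟨ *-identityʳ (L * L) ⟨
      L * L * 1ℤ ∎)

  isomorphic : Isomorphic Δ Γ
  isomorphic = σ , λ i j → begin
    S Γ i j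
      ≡⟨ P-conjugate i j ⟩
    dot (col P i) (matVec (S Δ) (col P j))
      ≡⟨ dot-congˡ (matVec (S Δ) (col P j)) (P≡ i) ⟩
    dot (idℤ (σ ⟨$⟩ʳ i)) (matVec (S Δ) (col P j))
      ≡⟨ sum-idˡ (σ ⟨$⟩ʳ i) (matVec (S Δ) (col P j)) ⟩
    dot (S Δ (σ ⟨$⟩ʳ i)) (col P j)
      ≡⟨ dot-comm (S Δ (σ ⟨$⟩ʳ i)) (col P j) ⟩
    dot (col P j) (S Δ (σ ⟨$⟩ʳ i))
      ≡⟨ dot-congˡ (S Δ (σ ⟨$⟩ʳ i)) (P≡ j) ⟩
    dot (idℤ (σ ⟨$⟩ʳ j)) (S Δ (σ ⟨$⟩ʳ i))
      ≡⟨ sum-idˡ (σ ⟨$⟩ʳ j) (S Δ (σ ⟨$⟩ʳ i)) ⟩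
    S Δ (σ ⟨$⟩ʳ i) (σ ⟨$⟩ʳ j) ∎
    where
    σP : ∃ λ (σ : Permutation′ n) → ∀ j k → P k j ≡ idℤ (σ ⟨$⟩ʳ j) k
    σP = standard-matrix P P-orthogonal P-row-sum P-column-sum
    σ : Permutation′ n
    σ = proj₁ σP
    P≡ : ∀ j k → P k j ≡ idℤ (σ ⟨$⟩ʳ j) k
    P≡ = proj₂ σP

-- The square of the level divides the products of columns

pos-^ : ∀ a k → pos (a ℕ.^ k) ≡ pos a ^ k
pos-^ a zero = refl
pos-^ a (suc k) = trans (ℤₚ.pos-* a (a ℕ.^ k)) (cong (pos a *_) (pos-^ a k))

halve : ∀ n → n ≡ ⌊ n /2⌋ ℕ.* 2 ⊎ n ≡ suc (⌊ n /2⌋ ℕ.* 2)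
halve zero = inj₁ refl
halve (suc zero) = inj₂ refl
halve (suc (suc n)) = Sum.map (cong (λ k → suc (suc k))) (cong (λ k → suc (suc k))) (halve n)

module _ {n} {Σ′ Δ Γ : OrientedGraph n} (Σ′∈G : InG Σ′) (ℓ : ℕ) .{{ℓ≢0 : ℕ.NonZero ℓ}} {N N₁ : Mat ℤ n}
  (con : ScaledConjugation Σ′ Δ (pos ℓ) N) (con₁ : ScaledConjugation Σ′ Γ (pos ℓ) N₁)
  (N-primitive : ∀ p → Prime p → pos p ∣ pos ℓ → Primitive p N)
  (N₁-primitive : ∀ p → Prime p → pos p ∣ pos ℓ → Primitive p N₁) where

  private
    L≢0 : pos ℓ ≢ 0ℤ
    L≢0 eq = ℕ.≢-nonZero⁻¹ ℓ (ℤₚ.+-injective eq)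

    m : ℤ
    m = proj₁ Σ′∈G

    detW : det (walkMatrix Σ′) ≡ pos 2 ^ ⌊ n /2⌋ * m
    detW = trans (proj₁ (proj₂ Σ′∈G)) (cong (_* m) (pos-^ 2 ⌊ n /2⌋))

    -- If ℓ were even, every column of `N` would satisfy the hypotheses of `even-vector`, its norms
    -- being multiples of ℓ²; so `N` would be even, against primitivity.
    odd-level : ¬ (pos 2 ∣ pos ℓ)
    odd-level 2∣ℓ with N-primitive 2 prime[2] 2∣ℓ
    ... | i , j , 2∤N = 2∤N (even-vector Σ′ ⌊ n /2⌋ m (halve n) (λ 2∣m → proj₁ (proj₂ (proj₂ Σ′∈G)) (∣⇒∣ᵤ 2∣m)) detW
      (col N j) (λ t → ∣-trans 2∣ℓ (column-walk j t)) (λ b → ∣-trans (2∣*2∣ 2∣ℓ 2∣ℓ) (column-pow j b)) i)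
      where open Conjugation L≢0 con

    local : ∀ i j p → Prime p → pos p ∣ pos ℓ → ¬ (pos p ^ 2 ∣ pos ℓ) × pos p ^ 2 ∣ dot (col N i) (col N₁ j)
    local i j p p-prime p∣ℓ =
      p²∤level L≢0 con (N-primitive p p-prime p∣ℓ) ,
      columns-dot L≢0 p∣ℓ con con₁ (N-primitive p p-prime p∣ℓ) (N₁-primitive p p-prime p∣ℓ) i j
      where
      p²∤m : ¬ (pos p ^ 2 ∣ m)
      p²∤m p²∣m = proj₂ (proj₂ (proj₂ Σ′∈G)) p p-prime
        (∣⇒∣ᵤ (subst (_∣ m) (cong (pos p *_) (*-identityʳ (pos p))) p²∣m))
      p≢2 : p ≢ 2
      p≢2 refl = odd-level p∣ℓ
      open OddPrime Σ′ p-prime p≢2 ⌊ n /2⌋ m p²∤m detW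

    L²∣ : ∀ i j → pos ℓ * pos ℓ ∣ dot (col N i) (col N₁ j)
    L²∣ i j with factorise ℓ
    ... | record { factors = ps ; isFactorisation = ℓ≡Π ; factorsPrime = ps-prime } =
      subst (λ k → pos k * pos k ∣ dot (col N i) (col N₁ j)) (sym ℓ≡Π)
        (square-∣ ps ps-prime (subst
          (λ k → ∀ p → Prime p → pos p ∣ pos k → ¬ (pos p ^ 2 ∣ pos k) × pos p ^ 2 ∣ dot (col N i) (col N₁ j))
          ℓ≡Π (local i j)))

  same-level-isomorphic : Isomorphic Δ Γ
  same-level-isomorphic = isomorphic L≢0 con con₁ L²∣

-- Rational matrices

open CommutativeSemigroupProperties (CommutativeMonoid.commutativeSemigroup ℚₚ.*-1-commutativeMonoid)
  using () renaming (interchange to ℚ-interchange)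

-- `toℚ` normalises its fraction, so the comparison is made on unnormalised representatives; the `0`
-- in `mkℚᵘ a 0` is the denominator less one.
toℚ-injective : ∀ {a b} → toℚ a ≡ toℚ b → a ≡ b
toℚ-injective {a} {b} eq with fromℚᵘ-injective {mkℚᵘ a 0} {mkℚᵘ b 0} eq
... | *≡* a*1≡b*1 = trans (sym (*-identityʳ a)) (trans a*1≡b*1 (*-identityʳ b))

toℚ-+ : ∀ a b → toℚ (a + b) ≡ toℚ a ℚ.+ toℚ b
toℚ-+ a b = toℚᵘ-injective (ℚᵘₚ.≃-trans (toℚᵘ-fromℚᵘ (mkℚᵘ (a + b) 0)) (ℚᵘₚ.≃-sym
  (ℚᵘₚ.≃-trans (toℚᵘ-homo-+ (toℚ a) (toℚ b)) (ℚᵘₚ.≃-trans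
    (ℚᵘₚ.+-cong (toℚᵘ-fromℚᵘ (mkℚᵘ a 0)) (toℚᵘ-fromℚᵘ (mkℚᵘ b 0))) (*≡* (cross a b))))))
  where
  cross : ∀ a b → (a * 1ℤ + b * 1ℤ) * 1ℤ ≡ (a + b) * (1ℤ * 1ℤ)
  cross = solve-∀

toℚ-* : ∀ a b → toℚ (a * b) ≡ toℚ a ℚ.* toℚ b
toℚ-* a b = toℚᵘ-injective (ℚᵘₚ.≃-trans (toℚᵘ-fromℚᵘ (mkℚᵘ (a * b) 0)) (ℚᵘₚ.≃-sym
  (ℚᵘₚ.≃-trans (toℚᵘ-homo-* (toℚ a) (toℚ b)) (ℚᵘₚ.≃-trans
    (ℚᵘₚ.*-cong (toℚᵘ-fromℚᵘ (mkℚᵘ a 0)) (toℚᵘ-fromℚᵘ (mkℚᵘ b 0))) (*≡* refl)))))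

sumℚ-cong : ∀ {n} {f g : Fin n → ℚ} → (∀ i → f i ≡ g i) → sumℚ f ≡ sumℚ g
sumℚ-cong {zero} f≗g = refl
sumℚ-cong {suc n} f≗g = cong₂ ℚ._+_ (f≗g zero) (sumℚ-cong (f≗g ∘ suc))

*-sumℚ : ∀ {n} α (f : Fin n → ℚ) → α ℚ.* sumℚ f ≡ sumℚ (λ i → α ℚ.* f i)
*-sumℚ {zero} α f = ℚₚ.*-zeroʳ α
*-sumℚ {suc n} α f = trans (ℚₚ.*-distribˡ-+ α (f zero) (sumℚ (f ∘ suc)))
  (cong (α ℚ.* f zero ℚ.+_) (*-sumℚ α (f ∘ suc)))

toℚ-sum : ∀ {n} (f : Fin n → ℤ) → toℚ (sumℤ f) ≡ sumℚ (toℚ ∘ f)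
toℚ-sum {zero} f = refl
toℚ-sum {suc n} f = trans (toℚ-+ (f zero) (sumℤ (f ∘ suc))) (cong (toℚ (f zero) ℚ.+_) (toℚ-sum (f ∘ suc)))

toℚ-⊗ : ∀ {n} (A B : Mat ℤ n) i j → toℚ ((A ⊗ B) i j) ≡ (toℚMat A · toℚMat B) i j
toℚ-⊗ A B i j = trans (toℚ-sum (λ k → A i k * B k j)) (sumℚ-cong (λ k → toℚ-* (A i k) (B k j)))

·-cong : ∀ {n} {A A′ B B′ : Mat ℚ n} → (∀ i j → A i j ≡ A′ i j) → (∀ i j → B i j ≡ B′ i j) →
  ∀ i j → (A · B) i j ≡ (A′ · B′) i j
·-cong A≋ B≋ i j = sumℚ-cong (λ k → cong₂ ℚ._*_ (A≋ i k) (B≋ k j))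

scaled-· : ∀ {n} q (A B : Mat ℚ n) i j → ((λ i j → q ℚ.* A i j) · B) i j ≡ q ℚ.* (A · B) i j
scaled-· q A B i j = trans (sumℚ-cong (λ k → ℚₚ.*-assoc q (A i k) (B k j))) (sym (*-sumℚ q (λ k → A i k ℚ.* B k j)))

scaled-·-scaled : ∀ {n} q (A B : Mat ℚ n) i j →
  ((λ i j → q ℚ.* A i j) · (λ i j → q ℚ.* B i j)) i j ≡ q ℚ.* q ℚ.* (A · B) i j
scaled-·-scaled q A B i j = trans (sumℚ-cong (λ k → ℚ-interchange q (A i k) q (B k j)))
  (sym (*-sumℚ (q ℚ.* q) (λ k → A i k ℚ.* B k j)))

*-cancelℚ : ∀ c {x y} → c ≢ 0ℚ → c ℚ.* x ≡ c ℚ.* y → x ≡ y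
*-cancelℚ c {x} {y} c≢0 eq = trans (sym (undo x)) (trans (cong (inv ℚ.*_) eq) (undo y))
  where
  inv : ℚ
  inv = ℚ.1/_ c {{ℚ.≢-nonZero c≢0}}
  undo : ∀ z → inv ℚ.* (c ℚ.* z) ≡ z
  undo z = trans (sym (ℚₚ.*-assoc inv c z))
    (trans (cong (ℚ._* z) (ℚₚ.*-inverseˡ c {{ℚ.≢-nonZero c≢0}})) (ℚₚ.*-identityˡ z))

module Level {n} {Q : Mat ℚ n} {ℓ : ℕ} (level : HasLevel Q ℓ) where

  q : ℚ
  q = toℚ (pos ℓ)

  N : Mat ℤ n
  N i j = proj₁ (proj₁ (proj₂ level) i j)

  qQ≡N : ∀ i j → q ℚ.* Q i j ≡ toℚ (N i j)
  qQ≡N i j = proj₂ (proj₁ (proj₂ level) i j)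

  toℚ-L² : ∀ x → toℚ (pos ℓ * pos ℓ * x) ≡ q ℚ.* q ℚ.* toℚ x
  toℚ-L² x = trans (toℚ-* (pos ℓ * pos ℓ) x) (cong (ℚ._* toℚ x) (toℚ-* (pos ℓ) (pos ℓ)))

  scaledConjugation : ∀ {Σ′ Δ : OrientedGraph n} → Orthogonal Q → Regular Q →
    (∀ i j → conj Q (S Σ′) i j ≡ toℚ (S Δ i j)) → ScaledConjugation Σ′ Δ (pos ℓ) N
  scaledConjugation {Σ′} {Δ} orthogonal regular conjugate = record
    { orthogonal = λ i j → toℚ-injective (begin
        toℚ ((col N ⊗ N) i j)
          ≡⟨ toℚ-⊗ (col N) N i j ⟩
        (toℚMat (col N) · toℚMat N) i j
          ≡⟨ ·-cong (λ i j → qQ≡N j i) qQ≡N i j ⟨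
        ((λ i j → q ℚ.* transpose Q i j) · (λ i j → q ℚ.* Q i j)) i j
          ≡⟨ scaled-·-scaled q (transpose Q) Q i j ⟩
        q ℚ.* q ℚ.* (transpose Q · Q) i j
          ≡⟨ cong (q ℚ.* q ℚ.*_) (orthogonal i j) ⟩
        q ℚ.* q ℚ.* toℚ (idℤ i j)
          ≡⟨ toℚ-L² (idℤ i j) ⟨
        toℚ (pos ℓ * pos ℓ * idℤ i j) ∎)
    ; row-sum = λ i → toℚ-injective (begin
        toℚ (sumℤ (N i))              ≡⟨ toℚ-sum (N i) ⟩
        sumℚ (λ j → toℚ (N i j))      ≡⟨ sumℚ-cong (qQ≡N i) ⟨
        sumℚ (λ j → q ℚ.* Q i j)      ≡⟨ *-sumℚ q (Q i) ⟨
        q ℚ.* sumℚ (Q i)              ≡⟨ cong (q ℚ.*_) (regular i) ⟩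
        q ℚ.* 1ℚ                      ≡⟨ ℚₚ.*-identityʳ q ⟩
        q ∎)
    ; conjugate = λ i j → toℚ-injective (begin
        toℚ ((col N ⊗ (S Σ′ ⊗ N)) i j)
          ≡⟨ cong toℚ (⊗-assoc (col N) (S Σ′) N i j) ⟨
        toℚ (((col N ⊗ S Σ′) ⊗ N) i j)
          ≡⟨ toℚ-⊗ (col N ⊗ S Σ′) N i j ⟩
        (toℚMat (col N ⊗ S Σ′) · toℚMat N) i j
          ≡⟨ ·-cong left (λ i j → sym (qQ≡N i j)) i j ⟩
        ((λ i j → q ℚ.* (transpose Q · toℚMat (S Σ′)) i j) · (λ i j → q ℚ.* Q i j)) i j
          ≡⟨ scaled-·-scaled q (transpose Q · toℚMat (S Σ′)) Q i j ⟩
        q ℚ.* q ℚ.* conj Q (S Σ′) i j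
          ≡⟨ cong (q ℚ.* q ℚ.*_) (conjugate i j) ⟩
        q ℚ.* q ℚ.* toℚ (S Δ i j)
          ≡⟨ toℚ-L² (S Δ i j) ⟨
        toℚ (pos ℓ * pos ℓ * S Δ i j) ∎)
    }
    where
    left : ∀ i k → toℚ ((col N ⊗ S Σ′) i k) ≡ q ℚ.* (transpose Q · toℚMat (S Σ′)) i k
    left i k = begin
      toℚ ((col N ⊗ S Σ′) i k)
        ≡⟨ toℚ-⊗ (col N) (S Σ′) i k ⟩
      (toℚMat (col N) · toℚMat (S Σ′)) i k
        ≡⟨ ·-cong {B = toℚMat (S Σ′)} (λ i j → qQ≡N j i) (λ _ _ → refl) i k ⟨
      ((λ i j → q ℚ.* transpose Q i j) · toℚMat (S Σ′)) i k
        ≡⟨ scaled-· q (transpose Q) (toℚMat (S Σ′)) i k ⟩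
      q ℚ.* (transpose Q · toℚMat (S Σ′)) i k ∎

  -- If `p` divided every entry of `N`, then ℓ/p would already clear the denominators of `Q`,
  -- against the minimality of the level.
  primitive-N : ∀ p → Prime p → pos p ∣ pos ℓ → Primitive p N
  primitive-N p p-prime p∣ℓ with all? (λ i → all? (λ j → pos p ∣? N i j))
  ... | no ¬p∣N with ¬∀⟶∃¬ n _ (λ i → all? (λ j → pos p ∣? N i j)) ¬p∣N
  ...   | i , ¬p∣Nᵢ with unit-entry (N i) ¬p∣Nᵢ
  ...     | j , p∤N = i , j , p∤N
  primitive-N p p-prime p∣ℓ | yes p∣N with ∣⇒∣ᵤ p∣ℓ
  ... | ℕDiv.divides k ℓ≡kp = contradiction (proj₂ (proj₂ level) k k>0 integral) (ℕₚ.<⇒≱ k<ℓ)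
    where
    k>0 : 0 ℕ.< k
    k>0 = ℕₚ.n≢0⇒n>0 (λ k≡0 → ℕₚ.<⇒≢ (proj₁ level) (sym (trans ℓ≡kp (cong (ℕ._* p) k≡0))))
    k<ℓ : k ℕ.< ℓ
    k<ℓ = subst (k ℕ.<_) (sym ℓ≡kp) (ℕₚ.m<m*n k p {{ℕ.>-nonZero k>0}} (ℕ.nonTrivial⇒n>1 p {{prime⇒nonTrivial p-prime}}))
    p≢0 : toℚ (pos p) ≢ 0ℚ
    p≢0 eq = ℕ.≢-nonZero⁻¹ p {{prime⇒nonZero p-prime}} (ℤₚ.+-injective (toℚ-injective {pos p} {0ℤ} eq))
    integral : IntegralMat (scale k Q)
    integral i j with p∣N i j
    ... | divides z N≡zp = z , *-cancelℚ (toℚ (pos p)) p≢0 (begin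
      toℚ (pos p) ℚ.* (toℚ (pos k) ℚ.* Q i j)   ≡⟨ ℚₚ.*-assoc (toℚ (pos p)) (toℚ (pos k)) (Q i j) ⟨
      toℚ (pos p) ℚ.* toℚ (pos k) ℚ.* Q i j     ≡⟨ cong (ℚ._* Q i j) pk≡ℓ ⟩
      q ℚ.* Q i j                               ≡⟨ qQ≡N i j ⟩
      toℚ (N i j)                               ≡⟨ cong toℚ (trans N≡zp (ℤₚ.*-comm z (pos p))) ⟩
      toℚ (pos p * z)                           ≡⟨ toℚ-* (pos p) z ⟩
      toℚ (pos p) ℚ.* toℚ z ∎)
      where
      pk≡ℓ : toℚ (pos p) ℚ.* toℚ (pos k) ≡ q
      pk≡ℓ = trans (sym (toℚ-* (pos p) (pos k)))
        (cong toℚ (trans (sym (ℤₚ.pos-* p k)) (cong pos (trans (ℕₚ.*-comm p k) (sym ℓ≡kp)))))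

theorem1p5 : ∀ (n : ℕ) (Σ' Δ Γ : OrientedGraph n) →
    InG Σ' → InG Δ → InG Γ →
    GenCospectral Σ' Δ → GenCospectral Σ' Γ → GenCospectral Δ Γ →
    ∀ (Q Q₁ : Mat ℚ n) (ℓ : ℕ) →
    InQ Σ' Q → InQ Σ' Q₁ → HasLevel Q ℓ → HasLevel Q₁ ℓ →
    (∀ i j → conj Q (S Σ') i j ≡ toℚ (S Δ i j)) →
    (∀ i j → conj Q₁ (S Σ') i j ≡ toℚ (S Γ i j)) →
    Isomorphic Δ Γ
theorem1p5 n Σ' Δ Γ Σ'∈G _ _ _ _ _ Q Q₁ ℓ (orth , reg , _) (orth₁ , reg₁ , _) level level₁ conj≡Δ conj≡Γ =
  same-level-isomorphic {Σ′ = Σ'} {Δ} {Γ} Σ'∈G ℓ {{ℕ.>-nonZero (proj₁ level)}}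
    (Level.scaledConjugation level {Σ'} {Δ} orth reg conj≡Δ) (Level.scaledConjugation level₁ {Σ'} {Γ} orth₁ reg₁ conj≡Γ)
    (Level.primitive-N level) (Level.primitive-N level₁)
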